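{- For any fixed integer $r\geq 2$, $$m(n,r)= \Omega\left( \left(\frac{n}{\ln(n)}\right)^{\frac{r-1}{r}} r^n\right)\qquad\text{as } n\to\infty.$$ That is, for every integer $r\ge 2$ there exist a constant $C=C(r)>0$ and an integer $n_0=n_0(r)$ such that $m(n,r)\geq C\left(\frac{n}{\ln(n)}\right)^{\frac{r-1}{r}} r^n$ for all integers $n\ge n_0$.
   Context: A (finite) hypergraph is a pair $(V,E)$, where $V$ is a finite set of vertices and $E$ is a family (set) of subsets of $V$, called edges. It is $n$-uniform if all its edges have exactly $n$ elements. It is $r$-colorable if there exists a function $c:V\to\{1,\ldots,r\}$ such that no edge is monochromatic, i.e. the image under $c$ of every edge has at least two elements. For $n,r\in\mathbb{N}$, $m(n,r)$ denotes the smallest number of edges of an $n$-uniform hypergraph that is not $r$-colorable. The asymptotics are for fixed $r$ and $n$ tending to infinity. -}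

module Defs where

open import Data.Fin.Base using (Fin)
open import Data.Fin.Subset using (Subset; ∣_∣; _∈_)
open import Data.Integer.Base as ℤ using (+_)
import Data.Integer.Properties as ℤ
open import Data.List.Base using (List; length)
open import Data.List.Relation.Unary.All using (All)
open import Data.List.Relation.Unary.Unique.Propositional using (Unique)
open import Data.Nat.Base as ℕ using (ℕ; zero; suc; NonZero; NonTrivial)
import Data.Nat.Properties as ℕ
import Data.Nat.Coprimality as Coprime
open import Data.Product.Base using (∃; ∃₂; ∃-syntax; _×_; _,_; proj₁)
open import Data.Rational.Base as ℚ using (ℚ; mkℚ; 0ℚ; 1ℚ; ½; _<_; _≤_; *<*; *≤*)
import Data.Rational.Properties as ℚ
open import Data.Rational.Solver using (module +-*-Solver)
open import Data.Sum.Base as Sum using (_⊎_; inj₁; inj₂)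
open import Function.Bundles using (_⇔_; mk⇔; Equivalence)
open import Relation.Binary.PropositionalEquality as ≡
  using (_≡_; _≢_; refl; cong; cong₂; subst; subst₂)
open import Relation.Nullary using (¬_; yes; no; contradiction)

module RationalLemmas where

  open import Data.Rational.Base using (_+_; _*_; _-_; -_; _/_)

  nat : ℕ → ℚ
  nat n = mkℚ (+ n) 0 (Coprime.sym (Coprime.1-coprimeTo n))

  -- recip n is 1 / (n + 1).

  recip : ℕ → ℚ
  recip n = mkℚ (+ 1) n (Coprime.1-coprimeTo (suc n))

  nat≡ : ∀ n → nat n ≡ + n / 1
  nat≡ n = ≡.sym (ℚ.↥p/↧p≡p (nat n))

  nat-mono-≤ : ∀ {m n} → m ℕ.≤ n → nat m ≤ nat n
  nat-mono-≤ {m} {n} m≤n = *≤* (subst₂ ℤ._≤_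
    (≡.sym (ℤ.*-identityʳ (+ m))) (≡.sym (ℤ.*-identityʳ (+ n))) (ℤ.+≤+ m≤n))

  nat-+ : ∀ m n → nat (m ℕ.+ n) ≡ nat m + nat n
  nat-+ m n = ≡.trans (nat≡ (m ℕ.+ n)) (cong (_/ 1) (≡.sym
    (cong₂ ℤ._+_ (ℤ.*-identityʳ (+ m)) (ℤ.*-identityʳ (+ n)))))

  nat-* : ∀ m n → nat (m ℕ.* n) ≡ nat m * nat n
  nat-* m n = ≡.trans (nat≡ (m ℕ.* n)) (cong (_/ 1) (ℤ.pos-* m n))

  recip>0 : ∀ n → 0ℚ < recip n
  recip>0 n = ℚ.positive⁻¹ (recip n)

  recip-anti : ∀ {m n} → m ℕ.≤ n → recip n ≤ recip m
  recip-anti {m} {n} m≤n = *≤* (subst₂ ℤ._≤_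
    (≡.sym (ℤ.*-identityˡ (+ suc m))) (≡.sym (ℤ.*-identityˡ (+ suc n)))
    (ℤ.+≤+ (ℕ.s≤s m≤n)))

  nat*recip≡1 : ∀ n → nat (suc n) * recip n ≡ 1ℚ
  nat*recip≡1 n = ℚ.*-inverseʳ (nat (suc n))

  *-pos : ∀ {p q} → 0ℚ < p → 0ℚ < q → 0ℚ < p * q
  *-pos {p} {q} p>0 q>0 = ℚ.positive⁻¹ (p * q)
    {{ℚ.pos*pos⇒pos p {{ℚ.positive p>0}} q {{ℚ.positive q>0}}}}

  *-monoˡ-≤ : ∀ {p q r} → 0ℚ ≤ r → p ≤ q → p * r ≤ q * r
  *-monoˡ-≤ {r = r} r≥0 = ℚ.*-monoʳ-≤-nonNeg r {{ℚ.nonNegative r≥0}}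

  *-monoʳ-≤ : ∀ {p q r} → 0ℚ ≤ r → p ≤ q → r * p ≤ r * q
  *-monoʳ-≤ {r = r} r≥0 = ℚ.*-monoˡ-≤-nonNeg r {{ℚ.nonNegative r≥0}}

  *-monoˡ-< : ∀ {p q r} → 0ℚ < r → p < q → p * r < q * r
  *-monoˡ-< {r = r} r>0 = ℚ.*-monoˡ-<-pos r {{ℚ.positive r>0}}

  *-monoʳ-< : ∀ {p q r} → 0ℚ < r → p < q → r * p < r * q
  *-monoʳ-< {r = r} r>0 = ℚ.*-monoʳ-<-pos r {{ℚ.positive r>0}}

  *-cancelʳ-< : ∀ {p q r} → 0ℚ < r → p * r < q * r → p < q
  *-cancelʳ-< {r = r} r>0 = ℚ.*-cancelʳ-<-nonNeg r {{ℚ.nonNegative (ℚ.<⇒≤ r>0)}}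

  inverse : ∀ {p} → 0ℚ < p → ∃[ p⁻¹ ] 0ℚ < p⁻¹ × p⁻¹ * p ≡ 1ℚ
  inverse {p} p>0 =
    let instance
          p-pos = ℚ.positive p>0
          p≢0   = ℚ.pos⇒nonZero p
    in ℚ.1/ p , ℚ.positive⁻¹ (ℚ.1/ p) {{ℚ.1/pos⇒pos p}} , ℚ.*-inverseˡ p

  inverse-cancel : ∀ a i p → i * a ≡ 1ℚ → a * (i * p) ≡ p
  inverse-cancel a i p ia≡1 = begin
    a * (i * p)  ≡⟨ ℚ.*-assoc a i p ⟨
    a * i * p    ≡⟨ cong (_* p) (ℚ.*-comm a i) ⟩
    i * a * p    ≡⟨ cong (_* p) ia≡1 ⟩
    1ℚ * p       ≡⟨ ℚ.*-identityˡ p ⟩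
    p            ∎
    where open ≡.≡-Reasoning

  cross-divide : ∀ a b i j p q → 0ℚ < i → 0ℚ < j → i * a ≡ 1ℚ → j * b ≡ 1ℚ →
                 b * p < a * q → i * p < j * q
  cross-divide a b i j p q i>0 j>0 ia≡1 jb≡1 bp<aq = begin-strict
    i * p              ≡⟨ inverse-cancel b j (i * p) jb≡1 ⟨
    b * (j * (i * p))  ≡⟨ solve 4 (λ b i j p → b :* (j :* (i :* p)) := i :* j :* (b :* p)) refl b i j p ⟩
    i * j * (b * p)    <⟨ *-monoʳ-< (*-pos i>0 j>0) bp<aq ⟩
    i * j * (a * q)    ≡⟨ solve 4 (λ a i j q → i :* j :* (a :* q) := a :* (i :* (j :* q))) refl a i j q ⟩
    a * (i * (j * q))  ≡⟨ inverse-cancel a i (j * q) ia≡1 ⟩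
    j * q              ∎
    where
    open ℚ.≤-Reasoning
    open +-*-Solver

  p<p+q : ∀ p {q} → 0ℚ < q → p < p + q
  p<p+q p {q} q>0 = subst (_< p + q) (ℚ.+-identityʳ p) (ℚ.+-monoʳ-< p q>0)

  p<q⇒0<q-p : ∀ {p q} → p < q → 0ℚ < q - p
  p<q⇒0<q-p {p} {q} p<q = subst (_< q - p) (ℚ.+-inverseʳ p) (ℚ.+-monoˡ-< (- p) p<q)

  p+[q-p]≡q : ∀ p q → p + (q - p) ≡ q
  p+[q-p]≡q = solve 2 (λ p q → p :+ (q :+ (:- p)) := q) refl
    where open +-*-Solver

  archimedean : ∀ q → ∃[ n ] q < nat n
  archimedean (mkℚ q d _) = suc ℤ.∣ q ∣ , *<* (ℤ.≤-<-trans
    (subst (ℤ._≤ + ℤ.∣ q ∣) (≡.sym (ℤ.*-identityʳ q)) (i≤∣i∣ q))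
    (ℤ.+<+ (ℕ.m≤m*n (suc ℤ.∣ q ∣) (suc d))))
    where
    i≤∣i∣ : ∀ i → i ℤ.≤ + ℤ.∣ i ∣
    i≤∣i∣ (+ n)        = ℤ.≤-refl
    i≤∣i∣ ℤ.-[1+ n ] = ℤ.-≤+

  small-recip : ∀ {ε} → 0ℚ < ε → ∃[ k ] recip k < ε
  small-recip {ε} ε>0 =
    let ε⁻¹ , _ , inv = inverse ε>0
        n , ε⁻¹<n     = archimedean ε⁻¹
        1<nε : 1ℚ < nat (suc n) * ε
        1<nε = subst (_< nat (suc n) * ε) inv
          (*-monoˡ-< ε>0 (ℚ.<-≤-trans ε⁻¹<n (nat-mono-≤ (ℕ.n≤1+n n))))
    in n , compare (nat (suc n)) (recip n) (ℚ.positive⁻¹ (nat (suc n))) (nat*recip≡1 n) 1<nε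
    where
    compare : ∀ m r → 0ℚ < m → m * r ≡ 1ℚ → 1ℚ < m * ε → r < ε
    compare m r m>0 mr≡1 1<mε = *-cancelʳ-< m>0
      (subst₂ _<_ (≡.trans (≡.sym mr≡1) (ℚ.*-comm m r)) (ℚ.*-comm m ε) 1<mε)

  infixr 8 _^_

  _^_ : ℚ → ℕ → ℚ
  q ^ zero  = 1ℚ
  q ^ suc n = q * q ^ n

  ^-pos : ∀ {q} n → 0ℚ < q → 0ℚ < q ^ n
  ^-pos zero    q>0 = ℚ.positive⁻¹ 1ℚ
  ^-pos (suc n) q>0 = *-pos q>0 (^-pos n q>0)

  ^-mono-≤ : ∀ {p q} n → 0ℚ < p → p ≤ q → p ^ n ≤ q ^ n
  ^-mono-≤ zero    p>0 p≤q = ℚ.≤-refl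
  ^-mono-≤ (suc n) p>0 p≤q = ℚ.≤-trans
    (*-monoʳ-≤ (ℚ.<⇒≤ p>0) (^-mono-≤ n p>0 p≤q))
    (*-monoˡ-≤ (ℚ.<⇒≤ (^-pos n (ℚ.<-≤-trans p>0 p≤q))) p≤q)

  ^-mono-< : ∀ {p q} n .{{_ : NonZero n}} → 0ℚ < p → p < q → p ^ n < q ^ n
  ^-mono-< (suc n) p>0 p<q = ℚ.≤-<-trans
    (*-monoʳ-≤ (ℚ.<⇒≤ p>0) (^-mono-≤ n p>0 (ℚ.<⇒≤ p<q)))
    (*-monoˡ-< (^-pos n (ℚ.<-trans p>0 p<q)) p<q)

  1^n≡1 : ∀ n → 1ℚ ^ n ≡ 1ℚ
  1^n≡1 zero    = refl
  1^n≡1 (suc n) = ≡.trans (ℚ.*-identityˡ (1ℚ ^ n)) (1^n≡1 n)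

  q≤1⇒q^n≤q : ∀ {q} n .{{_ : NonZero n}} → 0ℚ < q → q ≤ 1ℚ → q ^ n ≤ q
  q≤1⇒q^n≤q {q} (suc n) q>0 q≤1 = subst (q ^ suc n ≤_) (ℚ.*-identityʳ q)
    (*-monoʳ-≤ (ℚ.<⇒≤ q>0) (subst (q ^ n ≤_) (1^n≡1 n) (^-mono-≤ n q>0 q≤1)))

  1≤q⇒q≤q^n : ∀ {q} n .{{_ : NonZero n}} → 1ℚ ≤ q → q ≤ q ^ n
  1≤q⇒q≤q^n {q} (suc n) 1≤q = subst (_≤ q ^ suc n) (ℚ.*-identityʳ q)
    (*-monoʳ-≤ (ℚ.≤-trans (ℚ.<⇒≤ 1>0) 1≤q)
      (subst (_≤ q ^ n) (1^n≡1 n) (^-mono-≤ n 1>0 1≤q)))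
    where
    1>0 : 0ℚ < 1ℚ
    1>0 = ℚ.positive⁻¹ 1ℚ

  -- harmonic a n is 1/(a+1) + 1/(a+2) + ⋯ + 1/(a+n).

  harmonic : ℕ → ℕ → ℚ
  harmonic a zero    = 0ℚ
  harmonic a (suc n) = recip a + harmonic (suc a) n

  harmonic-≥0 : ∀ a n → 0ℚ ≤ harmonic a n
  harmonic-≥0 a zero    = ℚ.≤-refl
  harmonic-≥0 a (suc n) = ℚ.+-mono-≤ (ℚ.<⇒≤ (recip>0 a)) (harmonic-≥0 (suc a) n)

  harmonic->0 : ∀ a n .{{_ : NonZero n}} → 0ℚ < harmonic a n
  harmonic->0 a (suc n) = ℚ.+-mono-<-≤ (recip>0 a) (harmonic-≥0 (suc a) n)

  harmonic-+ : ∀ a m n → harmonic a (m ℕ.+ n) ≡ harmonic a m + harmonic (m ℕ.+ a) n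
  harmonic-+ a zero    n = ≡.sym (ℚ.+-identityˡ (harmonic a n))
  harmonic-+ a (suc m) n = begin
    recip a + harmonic (suc a) (m ℕ.+ n)
      ≡⟨ cong (λ h → recip a + h) (harmonic-+ (suc a) m n) ⟩
    recip a + (harmonic (suc a) m + harmonic (m ℕ.+ suc a) n)
      ≡⟨ cong (λ b → recip a + (harmonic (suc a) m + harmonic b n)) (ℕ.+-suc m a) ⟩
    recip a + (harmonic (suc a) m + harmonic (suc m ℕ.+ a) n)
      ≡⟨ ℚ.+-assoc (recip a) (harmonic (suc a) m) (harmonic (suc m ℕ.+ a) n) ⟨
    recip a + harmonic (suc a) m + harmonic (suc m ℕ.+ a) n ∎
    where open ≡.≡-Reasoning

  harmonic-anti : ∀ a n → harmonic (suc a) n ≤ harmonic a n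
  harmonic-anti a zero    = ℚ.≤-refl
  harmonic-anti a (suc n) =
    ℚ.+-mono-≤ (recip-anti (ℕ.n≤1+n a)) (harmonic-anti (suc a) n)

  harmonic-gap : ∀ a n → harmonic a n ≤ recip a + harmonic (suc a) n
  harmonic-gap a zero    = ℚ.+-monoˡ-≤ 0ℚ (ℚ.<⇒≤ (recip>0 a))
  harmonic-gap a (suc n) = ℚ.+-monoʳ-≤ (recip a) (harmonic-gap (suc a) n)

  harmonic-≤ : ∀ a n → harmonic a n ≤ nat n * recip a
  harmonic-≤ a zero    = ℚ.≤-reflexive (≡.sym (ℚ.*-zeroˡ (recip a)))
  harmonic-≤ a (suc n) = begin
    recip a + harmonic (suc a) n       ≤⟨ ℚ.+-monoʳ-≤ (recip a) (harmonic-anti a n) ⟩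
    recip a + harmonic a n             ≤⟨ ℚ.+-monoʳ-≤ (recip a) (harmonic-≤ a n) ⟩
    recip a + nat n * recip a          ≡⟨ cong (_+ nat n * recip a) (ℚ.*-identityˡ (recip a)) ⟨
    1ℚ * recip a + nat n * recip a     ≡⟨ ℚ.*-distribʳ-+ (recip a) 1ℚ (nat n) ⟨
    (1ℚ + nat n) * recip a             ≡⟨ cong (_* recip a) (nat-+ 1 n) ⟨
    nat (suc n) * recip a              ∎
    where open ℚ.≤-Reasoning

  harmonic-≥ : ∀ a n {b} → n ℕ.+ a ℕ.≤ suc b → nat n * recip b ≤ harmonic a n
  harmonic-≥ a zero    {b} _ = ℚ.≤-reflexive (ℚ.*-zeroˡ (recip b))
  harmonic-≥ a (suc n) {b} (ℕ.s≤s n+a≤b) = begin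
    nat (suc n) * recip b           ≡⟨ cong (_* recip b) (nat-+ 1 n) ⟩
    (1ℚ + nat n) * recip b          ≡⟨ ℚ.*-distribʳ-+ (recip b) 1ℚ (nat n) ⟩
    1ℚ * recip b + nat n * recip b  ≡⟨ cong (_+ nat n * recip b) (ℚ.*-identityˡ (recip b)) ⟩
    recip b + nat n * recip b       ≤⟨ ℚ.+-mono-≤ (recip-anti (ℕ.≤-trans (ℕ.m≤n+m a n) n+a≤b))
                                         (harmonic-≥ (suc a) n
                                           (subst (ℕ._≤ suc b) (≡.sym (ℕ.+-suc n a)) (ℕ.s≤s n+a≤b))) ⟩
    recip a + harmonic (suc a) n    ∎
    where open ℚ.≤-Reasoning

  recip-split : ∀ c l → recip c ≡ nat (suc l) * recip (l ℕ.+ c ℕ.* suc l)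
  recip-split c l = begin
    recip c                                  ≡⟨ ℚ.*-identityʳ (recip c) ⟨
    recip c * 1ℚ                             ≡⟨ cong (recip c *_) (nat*recip≡1 e) ⟨
    recip c * (nat (suc e) * recip e)        ≡⟨ cong (λ q → recip c * (q * recip e)) (nat-* (suc c) (suc l)) ⟩
    recip c * (nat (suc c) * nat (suc l) * recip e)
      ≡⟨ solve 4 (λ x y z w → x :* (y :* z :* w) := y :* x :* (z :* w)) refl
           (recip c) (nat (suc c)) (nat (suc l)) (recip e) ⟩
    nat (suc c) * recip c * (nat (suc l) * recip e)
      ≡⟨ cong (_* (nat (suc l) * recip e)) (nat*recip≡1 c) ⟩
    1ℚ * (nat (suc l) * recip e)             ≡⟨ ℚ.*-identityˡ _ ⟩
    nat (suc l) * recip e                    ∎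
    where
    open ≡.≡-Reasoning
    open +-*-Solver
    e = l ℕ.+ c ℕ.* suc l

  refine-lower : ∀ l c n → harmonic c n ≤ harmonic (c ℕ.* suc l) (n ℕ.* suc l)
  refine-lower l c zero    = ℚ.≤-refl
  refine-lower l c (suc n) = begin
    recip c + harmonic (suc c) n
      ≤⟨ ℚ.+-mono-≤ (ℚ.≤-trans (ℚ.≤-reflexive (recip-split c l))
                                 (harmonic-≥ (c ℕ.* suc l) (suc l) ℕ.≤-refl))
                    (refine-lower l (suc c) n) ⟩
    harmonic (c ℕ.* suc l) (suc l) + harmonic (suc c ℕ.* suc l) (n ℕ.* suc l)
      ≡⟨ harmonic-+ (c ℕ.* suc l) (suc l) (n ℕ.* suc l) ⟨
    harmonic (c ℕ.* suc l) (suc n ℕ.* suc l) ∎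
    where open ℚ.≤-Reasoning

  refine-upper : ∀ k c n → harmonic (k ℕ.+ c ℕ.* suc k) (n ℕ.* suc k) ≤ harmonic c n
  refine-upper k c zero    = ℚ.≤-refl
  refine-upper k c (suc n) = begin
    harmonic e (suc n ℕ.* suc k)
      ≡⟨ harmonic-+ e (suc k) (n ℕ.* suc k) ⟩
    harmonic e (suc k) + harmonic (suc k ℕ.+ e) (n ℕ.* suc k)
      ≡⟨ cong (λ a → harmonic e (suc k) + harmonic a (n ℕ.* suc k)) (ℕ.+-suc k e) ⟨
    harmonic e (suc k) + harmonic (k ℕ.+ suc c ℕ.* suc k) (n ℕ.* suc k)
      ≤⟨ ℚ.+-mono-≤ (ℚ.≤-trans (harmonic-≤ e (suc k))
                                 (ℚ.≤-reflexive (≡.sym (recip-split c k))))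
                    (refine-upper k (suc c) n) ⟩
    recip c + harmonic (suc c) n ∎
    where
    open ℚ.≤-Reasoning
    e = k ℕ.+ c ℕ.* suc k

  -- Lower and upper Riemann sums of ∫₁ⁿ dt/t for the partition of [1,n]
  -- into (n-1)(k+1) intervals of length 1/(k+1): on the j-th interval
  -- (counting from 0) the rectangles have areas 1/(k+1+j+1) and 1/(k+1+j).

  lowerSum upperSum : ℕ → ℕ → ℚ
  lowerSum n k = harmonic (suc k) ((n ℕ.∸ 1) ℕ.* suc k)
  upperSum n k = harmonic k ((n ℕ.∸ 1) ℕ.* suc k)

  lowerSum≤upperSum : ∀ n k l → lowerSum n k ≤ upperSum n l
  lowerSum≤upperSum n k l = begin
    harmonic (suc k) (m ℕ.* suc k)                                ≤⟨ refine-lower l (suc k) (m ℕ.* suc k) ⟩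
    harmonic (suc k ℕ.* suc l) (m ℕ.* suc k ℕ.* suc l)            ≡⟨ cong₂ harmonic (ℕ.*-comm (suc k) (suc l)) eq ⟩
    harmonic (suc l ℕ.* suc k) (m ℕ.* suc l ℕ.* suc k)            ≤⟨ harmonic-anti (k ℕ.+ l ℕ.* suc k) (m ℕ.* suc l ℕ.* suc k) ⟩
    harmonic (k ℕ.+ l ℕ.* suc k) (m ℕ.* suc l ℕ.* suc k)          ≤⟨ refine-upper k l (m ℕ.* suc l) ⟩
    harmonic l (m ℕ.* suc l)                                      ∎
    where
    open ℚ.≤-Reasoning
    m = n ℕ.∸ 1
    eq : m ℕ.* suc k ℕ.* suc l ≡ m ℕ.* suc l ℕ.* suc k
    eq = ≡.trans (ℕ.*-assoc m (suc k) (suc l))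
        (≡.trans (cong (m ℕ.*_) (ℕ.*-comm (suc k) (suc l)))
                 (≡.sym (ℕ.*-assoc m (suc l) (suc k))))

  lowerSum>0 : ∀ n k .{{_ : NonTrivial n}} → 0ℚ < lowerSum n k
  lowerSum>0 (suc (suc n)) k = harmonic->0 (suc k) (suc n ℕ.* suc k)

  sums-converge : ∀ n {p q} → p < q → ∃[ k ] (p < lowerSum n k ⊎ upperSum n k < q)
  sums-converge n {p} {q} p<q =
    let k , 1/k<q-p = small-recip (p<q⇒0<q-p p<q)
    in k , compare (recip k) (lowerSum n k) (upperSum n k)
             (harmonic-gap k ((n ℕ.∸ 1) ℕ.* suc k)) 1/k<q-p
    where
    open ℚ.≤-Reasoning
    compare : ∀ r l u → u ≤ r + l → r < q - p → p < l ⊎ u < q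
    compare r l u u≤r+l r<q-p with p ℚ.<? l
    ... | yes p<l = inj₁ p<l
    ... | no  p≮l = inj₂ (begin-strict
      u            ≤⟨ u≤r+l ⟩
      r + l        ≤⟨ ℚ.+-monoʳ-≤ r (ℚ.≮⇒≥ p≮l) ⟩
      r + p        <⟨ ℚ.+-monoˡ-< p r<q-p ⟩
      (q - p) + p  ≡⟨ ℚ.+-comm (q - p) p ⟩
      p + (q - p)  ≡⟨ p+[q-p]≡q p q ⟩
      q            ∎)

-- Dedekind cuts: lower q means q < x and upper q means x < q.

record ℝ : Set₁ where
  field
    lower upper     : ℚ → Set
    lower-inhabited : ∃ lower
    upper-inhabited : ∃ upper
    lower-rounded   : ∀ q → lower q ⇔ (∃[ r ] q < r × lower r)
    upper-rounded   : ∀ q → upper q ⇔ (∃[ r ] r < q × upper r)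
    disjoint        : ∀ q → ¬ (lower q × upper q)
    located         : ∀ p q → p < q → lower p ⊎ upper q

infix 4 _≤ᴿ_

_≤ᴿ_ : ℝ → ℝ → Set
x ≤ᴿ y = ∀ q → ℝ.lower x q → ℝ.lower y q

record ℝ⁺ : Set₁ where
  field
    real     : ℝ
    positive : ℝ.lower real 0ℚ
  open ℝ real public

open ℝ⁺ using (real)

-- The real number that is both the supremum of A and the infimum of B.

module _
  (A B     : ℚ → Set)
  (A-inh   : ∃ A)
  (B-inh   : ∃ B)
  (A≤B     : ∀ {a b} → A a → B b → a ≤ b)
  (located : ∀ {p q} → p < q → (∃[ a ] A a × p < a) ⊎ (∃[ b ] B b × b < q))
  where

  cut : ℝ
  cut = record
    { lower           = λ q → ∃[ a ] A a × q < a
    ; upper           = λ q → ∃[ b ] B b × b < q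
    ; lower-inhabited = let a , Aa = A-inh in
        a ℚ.- 1ℚ , a , Aa , subst (a ℚ.- 1ℚ <_) (ℚ.+-identityʳ a)
                              (ℚ.+-monoʳ-< a (ℚ.negative⁻¹ (ℚ.- 1ℚ)))
    ; upper-inhabited = let b , Bb = B-inh in
        b ℚ.+ 1ℚ , b , Bb , RationalLemmas.p<p+q b (ℚ.positive⁻¹ 1ℚ)
    ; lower-rounded   = λ q → mk⇔
        (λ (a , Aa , q<a) → let r , q<r , r<a = ℚ.<-dense q<a in r , q<r , a , Aa , r<a)
        (λ (r , q<r , a , Aa , r<a) → a , Aa , ℚ.<-trans q<r r<a)
    ; upper-rounded   = λ q → mk⇔
        (λ (b , Bb , b<q) → let r , b<r , r<q = ℚ.<-dense b<q in r , r<q , b , Bb , b<r)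
        (λ (r , r<q , b , Bb , b<r) → b , Bb , ℚ.<-trans b<r r<q)
    ; disjoint        = λ q ((a , Aa , q<a) , (b , Bb , b<q)) →
        ℚ.<-irrefl refl (ℚ.<-≤-trans (ℚ.<-trans b<q q<a) (A≤B Aa Bb))
    ; located         = λ p q → located
    }

module _
  (A B     : ℚ → Set)
  (A>0     : ∀ {a} → A a → 0ℚ < a)
  (A-inh   : ∃ A)
  (B-inh   : ∃ B)
  (A≤B     : ∀ {a b} → A a → B b → a ≤ b)
  (located : ∀ {p q} → 0ℚ < p → p < q →
             (∃[ a ] A a × p < a) ⊎ (∃[ b ] B b × b < q))
  where

  cut⁺ : ℝ⁺
  cut⁺ = record
    { real     = cut A B A-inh B-inh A≤B located′
    ; positive = let a , Aa = A-inh in a , Aa , A>0 Aa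
    }
    where
    located′ : ∀ {p q} → p < q → (∃[ a ] A a × p < a) ⊎ (∃[ b ] B b × b < q)
    located′ {p} p<q with 0ℚ ℚ.<? p
    ... | yes p>0 = located p>0 p<q
    ... | no  p≯0 = let a , Aa = A-inh in
      inj₁ (a , Aa , ℚ.≤-<-trans (ℚ.≮⇒≥ p≯0) (A>0 Aa))

fromℚ : ℚ → ℝ
fromℚ q = cut (_≡ q) (_≡ q) (q , refl) (q , refl)
  (λ a≡q b≡q → ℚ.≤-reflexive (≡.trans a≡q (≡.sym b≡q))) loc
  where
  loc : ∀ {p r} → p < r → (∃[ a ] a ≡ q × p < a) ⊎ (∃[ b ] b ≡ q × b < r)
  loc {p} p<r with p ℚ.<? q
  ... | yes p<q = inj₁ (q , refl , p<q)
  ... | no  p≮q = inj₂ (q , refl , ℚ.≤-<-trans (ℚ.≮⇒≥ p≮q) p<r)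

fromℕ : ℕ → ℝ
fromℕ n = fromℚ (+ n ℚ./ 1)

fromℕ⁺ : (n : ℕ) .{{_ : NonZero n}} → ℝ⁺
fromℕ⁺ n = record
  { real     = fromℕ n
  ; positive = + n ℚ./ 1 , refl , ℚ.positive⁻¹ _ {{ℚ.normalize-pos n 1}}
  }

module Approximation (x : ℝ⁺) where

  open RationalLemmas
  open import Data.Rational.Base using (_+_; _*_; _-_)
  open ℝ⁺ x

  lower-< : ∀ {p q} → p < q → lower q → lower p
  lower-< {p} {q} p<q lq = Equivalence.from (lower-rounded p) (q , p<q , lq)

  upper-< : ∀ {p q} → p < q → upper p → upper q
  upper-< {p} {q} p<q up = Equivalence.from (upper-rounded q) (p , p<q , up)

  lower-≤ : ∀ {p q} → p ≤ q → lower q → lower p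
  lower-≤ {p} {q} p≤q lq = let r , q<r , lr = Equivalence.to (lower-rounded q) lq in
    lower-< (ℚ.≤-<-trans p≤q q<r) lr

  upper-≤ : ∀ {p q} → p ≤ q → upper p → upper q
  upper-≤ {p} {q} p≤q up = let r , r<p , ur = Equivalence.to (upper-rounded p) up in
    upper-< (ℚ.<-≤-trans r<p p≤q) ur

  lower<upper : ∀ {p q} → lower p → upper q → p < q
  lower<upper lp uq = ℚ.≰⇒> λ q≤p → disjoint _ (lp , upper-≤ q≤p uq)

  upper>0 : ∀ {q} → upper q → 0ℚ < q
  upper>0 = lower<upper positive

  positive-lower : ∃[ l ] 0ℚ < l × lower l
  positive-lower = Equivalence.to (lower-rounded 0ℚ) positive

  search : ∀ δ → 0ℚ < δ → ∀ n a → lower a → upper (a + nat n * δ) →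
           ∃[ b ] a ≤ b × lower b × upper (b + δ + δ)
  search δ δ>0 zero a la u = contradiction
    (la , subst upper (≡.trans (cong (λ b → a + b) (ℚ.*-zeroˡ δ)) (ℚ.+-identityʳ a)) u)
    (disjoint a)
  search δ δ>0 (suc n) a la u
    with located (a + δ) (a + δ + δ) (p<p+q (a + δ) δ>0)
  ... | inj₂ done = a , ℚ.≤-refl , la , done
  ... | inj₁ next = let b , a+δ≤b , lb , ub = search δ δ>0 n (a + δ) next (subst upper eq u) in
    b , ℚ.≤-trans (ℚ.<⇒≤ (p<p+q a δ>0)) a+δ≤b , lb , ub
    where
    open +-*-Solver
    eq : a + nat (suc n) * δ ≡ a + δ + nat n * δ
    eq = ≡.trans (cong (λ m → a + m * δ) (nat-+ 1 n))
      (solve 3 (λ a m d → a :+ (con 1ℚ :+ m) :* d := a :+ d :+ m :* d) refl a (nat n) δ)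

  approximate : ∀ {p q} → 0ℚ < p → p < q →
                ∃₂ λ a b → (0ℚ < a × lower a) × upper b × b * p < a * q
  approximate {p} {q} p>0 p<q =
    let l , l>0 , ll        = positive-lower
        u , uu              = upper-inhabited
        p⁻¹ , p⁻¹>0 , p-inv = inverse p>0
        ε                   = l * (q - p) * p⁻¹
        ε>0                 = *-pos (*-pos l>0 (p<q⇒0<q-p p<q)) p⁻¹>0
        δ , δ>0 , 2δ<ε   = halve ε>0
        d⁻¹ , d⁻¹>0 , d-inv = inverse δ>0
        n , u/δ<n           = archimedean (u * d⁻¹)
        u<nδ : u < nat n * δ
        u<nδ = subst (_< nat n * δ)
          (≡.trans (ℚ.*-assoc u d⁻¹ δ) (≡.trans (cong (u *_) d-inv) (ℚ.*-identityʳ u)))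
          (*-monoˡ-< δ>0 u/δ<n)
        u<l+nδ : u < l + nat n * δ
        u<l+nδ = subst (_< l + nat n * δ) (ℚ.+-identityˡ u) (ℚ.+-mono-< l>0 u<nδ)
        a , l≤a , la , ub   = search δ δ>0 n l ll (upper-< u<l+nδ uu)
    in a , a + δ + δ , (ℚ.<-≤-trans l>0 l≤a , la) , ub ,
       bound l a δ p⁻¹ p-inv l≤a 2δ<ε
    where
    open +-*-Solver
    halve : ∀ {ε} → 0ℚ < ε → ∃[ δ ] 0ℚ < δ × δ + δ < ε
    halve {ε} ε>0 =
      let η , η>0 , η<ε = ℚ.<-dense ε>0
      in ½ * η , *-pos (ℚ.positive⁻¹ ½) η>0 ,
         subst (_< ε) (≡.sym (solve 1 (λ h → con ½ :* h :+ con ½ :* h := h) refl η)) η<ε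
    bound : ∀ l a δ p⁻¹ → p⁻¹ * p ≡ 1ℚ → l ≤ a → δ + δ < l * (q - p) * p⁻¹ →
            (a + δ + δ) * p < a * q
    bound l a δ p⁻¹ p-inv l≤a 2δ<ε = begin-strict
      (a + δ + δ) * p                  ≡⟨ solve 3 (λ a d p → (a :+ d :+ d) :* p := a :* p :+ (d :+ d) :* p) refl a δ p ⟩
      a * p + (δ + δ) * p              <⟨ ℚ.+-monoʳ-< (a * p) (*-monoˡ-< p>0 2δ<ε) ⟩
      a * p + l * (q - p) * p⁻¹ * p    ≡⟨ cong (λ b → a * p + b) (≡.trans (ℚ.*-assoc (l * (q - p)) p⁻¹ p)
                                            (≡.trans (cong (l * (q - p) *_) p-inv) (ℚ.*-identityʳ _))) ⟩
      a * p + l * (q - p)              ≤⟨ ℚ.+-monoʳ-≤ (a * p) (*-monoˡ-≤ (ℚ.<⇒≤ (p<q⇒0<q-p p<q)) l≤a) ⟩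
      a * p + a * (q - p)              ≡⟨ solve 3 (λ a p q → a :* p :+ a :* (q :+ (:- p)) := a :* q) refl a p q ⟩
      a * q                            ∎
      where open ℚ.≤-Reasoning

infixl 7 _*_ _/_
infix  8 _⁻¹
infixr 8 _^_ _^[_/_]

_*_ : ℝ⁺ → ℝ⁺ → ℝ⁺
x * y = cut⁺ Below Above
  (λ { (_ , _ , (a>0 , _) , (b>0 , _) , refl) → *-pos a>0 b>0 })
  (let a , a>0 , la = AX.positive-lower
       b , b>0 , lb = AY.positive-lower
   in _ , a , b , (a>0 , la) , (b>0 , lb) , refl)
  (let a , ua = X.upper-inhabited
       b , ub = Y.upper-inhabited
   in _ , a , b , ua , ub , refl)
  (λ { (_ , _ , (_ , la) , (b>0 , lb) , refl) (_ , _ , ua , ub , refl) → ℚ.≤-trans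
       (*-monoˡ-≤ (ℚ.<⇒≤ b>0) (ℚ.<⇒≤ (AX.lower<upper la ua)))
       (*-monoʳ-≤ (ℚ.<⇒≤ (AX.upper>0 ua)) (ℚ.<⇒≤ (AY.lower<upper lb ub))) })
  loc
  where
  open RationalLemmas hiding (_^_)
  module X = ℝ⁺ x
  module Y = ℝ⁺ y
  module AX = Approximation x
  module AY = Approximation y

  Below Above : ℚ → Set
  Below c = ∃₂ λ a b → (0ℚ < a × X.lower a) × (0ℚ < b × Y.lower b) × a ℚ.* b ≡ c
  Above c = ∃₂ λ a b → X.upper a × Y.upper b × a ℚ.* b ≡ c

  loc : ∀ {p q} → 0ℚ < p → p < q →
        (∃[ c ] Below c × p < c) ⊎ (∃[ c ] Above c × c < q)
  loc {p} {q} p>0 p<q =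
    let a , a′ , (a>0 , la) , ua′ , a′p<aq = AX.approximate p>0 p<q
        a′>0 = AX.upper>0 ua′
        i , i>0 , ia≡1  = inverse a>0
        j , j>0 , ja′≡1 = inverse a′>0
    in Sum.map
      (λ lip →
        let b , ip<b , lb = Equivalence.to (Y.lower-rounded (i ℚ.* p)) lip
        in a ℚ.* b , (a , b , (a>0 , la) , (ℚ.<-trans (*-pos i>0 p>0) ip<b , lb) , refl) ,
           subst (_< a ℚ.* b) (inverse-cancel a i p ia≡1) (*-monoʳ-< a>0 ip<b))
      (λ ujq →
        let b , b<jq , ub = Equivalence.to (Y.upper-rounded (j ℚ.* q)) ujq
        in a′ ℚ.* b , (a′ , b , ua′ , ub , refl) ,
           subst (a′ ℚ.* b <_) (inverse-cancel a′ j q ja′≡1) (*-monoʳ-< a′>0 b<jq))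
      (Y.located (i ℚ.* p) (j ℚ.* q)
        (cross-divide a a′ i j p q i>0 j>0 ia≡1 ja′≡1 a′p<aq))

_⁻¹ : ℝ⁺ → ℝ⁺
x ⁻¹ = cut⁺
  (λ c → 0ℚ < c × ∃[ b ] upper b × c ℚ.* b ≡ 1ℚ)
  (λ c → 0ℚ < c × ∃[ a ] (0ℚ < a × lower a) × c ℚ.* a ≡ 1ℚ)
  proj₁
  (let b , ub = upper-inhabited
       c , c>0 , cb≡1 = inverse (upper>0 ub)
   in c , c>0 , b , ub , cb≡1)
  (let a , a>0 , la = positive-lower
       c , c>0 , ca≡1 = inverse a>0
   in c , c>0 , a , (a>0 , la) , ca≡1)
  (λ { (c>0 , b , ub , cb≡1) (d>0 , a , (a>0 , la) , da≡1) →
       ℚ.<⇒≤ (reciprocal-anti a>0 (lower<upper la ub) d>0 c>0 da≡1 cb≡1) })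
  (λ p>0 p<q →
     let q>0 = ℚ.<-trans p>0 p<q
         p⁻¹ , p⁻¹>0 , p-inv = inverse p>0
         q⁻¹ , q⁻¹>0 , q-inv = inverse q>0
         q⁻¹<p⁻¹ = reciprocal-anti p>0 p<q p⁻¹>0 q⁻¹>0 p-inv q-inv
     in loc p>0 q>0 p⁻¹>0 q⁻¹>0 p-inv q-inv (located q⁻¹ p⁻¹ q⁻¹<p⁻¹))
  where
  open RationalLemmas hiding (_^_)
  open ℝ⁺ x
  open Approximation x

  reciprocal-anti : ∀ {a b c d} → 0ℚ < a → a < b → 0ℚ < c → 0ℚ < d →
                    c ℚ.* a ≡ 1ℚ → d ℚ.* b ≡ 1ℚ → d < c
  reciprocal-anti {a} {b} {c} {d} a>0 a<b c>0 d>0 ca≡1 db≡1 =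
    *-cancelʳ-< a>0 (subst (d ℚ.* a <_) (≡.trans db≡1 (≡.sym ca≡1)) (*-monoʳ-< d>0 a<b))

  loc : ∀ {p q p⁻¹ q⁻¹} → 0ℚ < p → 0ℚ < q → 0ℚ < p⁻¹ → 0ℚ < q⁻¹ →
    p⁻¹ ℚ.* p ≡ 1ℚ → q⁻¹ ℚ.* q ≡ 1ℚ → lower q⁻¹ ⊎ upper p⁻¹ →
    (∃[ c ] (0ℚ < c × ∃[ b ] upper b × c ℚ.* b ≡ 1ℚ) × p < c) ⊎
    (∃[ c ] (0ℚ < c × ∃[ a ] (0ℚ < a × lower a) × c ℚ.* a ≡ 1ℚ) × c < q)
  loc {p} {q} {p⁻¹} {q⁻¹} p>0 q>0 p⁻¹>0 q⁻¹>0 p-inv q-inv (inj₂ u) =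
    let b , b<p⁻¹ , ub = Equivalence.to (upper-rounded p⁻¹) u
        c , c>0 , cb≡1 = inverse (upper>0 ub)
    in inj₁ (c , (c>0 , b , ub , cb≡1) ,
             reciprocal-anti (upper>0 ub) b<p⁻¹ c>0 p>0 cb≡1 (≡.trans (ℚ.*-comm p p⁻¹) p-inv))
  loc {p} {q} {p⁻¹} {q⁻¹} p>0 q>0 p⁻¹>0 q⁻¹>0 p-inv q-inv (inj₁ l) =
    let a , q⁻¹<a , la = Equivalence.to (lower-rounded q⁻¹) l
        a>0 = ℚ.<-trans q⁻¹>0 q⁻¹<a
        c , c>0 , ca≡1 = inverse a>0
    in inj₂ (c , (c>0 , a , (a>0 , la) , ca≡1) ,
             reciprocal-anti q⁻¹>0 q⁻¹<a q>0 c>0 (≡.trans (ℚ.*-comm q q⁻¹) q-inv) ca≡1)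

_/_ : ℝ⁺ → ℝ⁺ → ℝ⁺
x / y = x * y ⁻¹

_^_ : ℝ⁺ → ℕ → ℝ⁺
x ^ zero  = fromℕ⁺ 1
x ^ suc n = x * x ^ n

root : (n : ℕ) .{{_ : NonZero n}} → ℝ⁺ → ℝ⁺
root n x = cut⁺
  (λ c → 0ℚ < c × lower (c ℚ^ n))
  (λ c → 0ℚ < c × upper (c ℚ^ n))
  proj₁
  below
  (let u , uu = upper-inhabited
       1+u>0 : 0ℚ < 1ℚ ℚ.+ u
       1+u>0 = ℚ.+-mono-< (ℚ.positive⁻¹ 1ℚ) (upper>0 uu)
       1≤1+u = ℚ.<⇒≤ (p<p+q 1ℚ (upper>0 uu))
       u<1+u = subst (_< 1ℚ ℚ.+ u) (ℚ.+-identityˡ u) (ℚ.+-monoˡ-< u (ℚ.positive⁻¹ 1ℚ))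
   in 1ℚ ℚ.+ u , 1+u>0 , upper-< (ℚ.<-≤-trans u<1+u (1≤q⇒q≤q^n n 1≤1+u)) uu)
  (λ { (c>0 , lc) (d>0 , ud) → ℚ.≮⇒≥ λ d<c →
       ℚ.<-asym (lower<upper lc ud) (^-mono-< n d>0 d<c) })
  (λ p>0 p<q →
     let s , p<s , s<q = ℚ.<-dense p<q
         t , s<t , t<q = ℚ.<-dense s<q
         s>0 = ℚ.<-trans p>0 p<s
     in Sum.map (λ ls → s , (s>0 , ls) , p<s)
                (λ ut → t , (ℚ.<-trans s>0 s<t , ut) , t<q)
                (located (s ℚ^ n) (t ℚ^ n) (^-mono-< n s>0 s<t)))
  where
  open RationalLemmas renaming (_^_ to _ℚ^_)
  open ℝ⁺ x
  open Approximation x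

  below : ∃[ c ] 0ℚ < c × lower (c ℚ^ n)
  below with positive-lower
  ... | l , l>0 , ll with l ℚ.≤? 1ℚ
  ...   | yes l≤1 = l , l>0 , lower-≤ (q≤1⇒q^n≤q n l>0 l≤1) ll
  ...   | no  l≰1 = 1ℚ , ℚ.positive⁻¹ 1ℚ ,
    subst lower (≡.sym (1^n≡1 n)) (lower-< (ℚ.≰⇒> l≰1) ll)

_^[_/_] : ℝ⁺ → (p q : ℕ) .{{_ : NonZero q}} → ℝ⁺
x ^[ p / q ] = root q (x ^ p)

instance
  nonTrivial⇒nonZero : ∀ {n} .{{_ : NonTrivial n}} → NonZero n
  nonTrivial⇒nonZero {n} = ℕ.nonTrivial⇒nonZero n

-- The natural logarithm, as the Riemann integral ∫₁ⁿ dt/t. It is positive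
-- because n ≥ 2.

ln : (n : ℕ) .{{_ : NonTrivial n}} → ℝ⁺
ln n = cut⁺ Lower Upper
  (λ { (k , refl) → lowerSum>0 n k })
  (lowerSum n 0 , 0 , refl)
  (upperSum n 0 , 0 , refl)
  (λ { (k , refl) (l , refl) → lowerSum≤upperSum n k l })
  (λ _ → loc)
  where
  open RationalLemmas

  Lower Upper : ℚ → Set
  Lower c = ∃[ k ] lowerSum n k ≡ c
  Upper c = ∃[ k ] upperSum n k ≡ c

  loc : ∀ {p q} → p < q → (∃[ a ] Lower a × p < a) ⊎ (∃[ b ] Upper b × b < q)
  loc p<q = let k , either = sums-converge n p<q in
    Sum.map (λ p<l → lowerSum n k , (k , refl) , p<l)
            (λ u<q → upperSum n k , (k , refl) , u<q) either

record Hypergraph : Set where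
  field
    order    : ℕ
    edges    : List (Subset order)
    distinct : Unique edges

  size : ℕ
  size = length edges

  Uniform : ℕ → Set
  Uniform n = All (λ e → ∣ e ∣ ≡ n) edges

  -- The image of e under c has at least two elements.

  NotMonochromatic : ∀ {r} → (Fin order → Fin r) → Subset order → Set
  NotMonochromatic c e = ∃₂ λ u v → u ∈ e × v ∈ e × c u ≢ c v

  Colorable : ℕ → Set
  Colorable r = ∃[ c ] All (NotMonochromatic {r} c) edges

open Hypergraph using (size; Uniform; Colorable)

-- The relation m(n,r) = k: k is the smallest number of edges of an n-uniform
-- hypergraph that is not r-colorable.

record m[_,_]≡_ (n r k : ℕ) : Set where
  field
    attained : ∃[ H ] Uniform H n × ¬ Colorable H r × size H ≡ k
    minimal  : ∀ H → Uniform H n → ¬ Colorable H r → k ℕ.≤ size H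

-- Give the vertices independent uniform weights in {0, …, M - 1}, where M = r B + T
-- and T / M is about (log n) / n, and join a lightest vertex of each edge to a heaviest
-- one.  If no r of these arcs form a path, then the length of a longest path leaving a
-- vertex is a proper colouring with r colours.  With positive probability no edge has
-- all its weights in an interval of length B, by a union bound over edges and intervals.
-- In a path of r arcs every arc then climbs by at least B, which confines the r - 1
-- joints to windows of T values each; consecutive edges share a joint, so by AM-GM a
-- given path of r edges occurs with probability about (T / M)^(r-1) r^(-rn), and there
-- are at most k^r candidates.  Hence 8 k^r (64 r² log₂ n)^(r-1) ≤ n^(r-1) r^(rn)
-- suffices for r-colourability.

module Submission where

-- Two opposing demands fix `T / M`. Ruling out short edges means that
-- `(r B / M) ^ n = (1 - T / M) ^ n` must beat a polynomial in `n`, which asks for `T / M` of order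
-- at least `(log n) / n`; the number of positions of the joints grows like `T ^ (r - 1)`, so
-- nothing larger is wanted. The event that a path has joints in given windows is not a product over
-- vertices, because the range of an edge depends on the weights of its joints. The union bound
-- therefore also runs over the exact weights of the joints. Once these are fixed, each vertex is
-- confined separately and the event is a box. A vertex common to two consecutive edges is pinned to
-- one value, so two factors `width / M` become `1 / M`: a correction of at most `M / B²`. Over the
-- `T ^ (r - 1)` positions this sums to `(T / M) ^ (r - 1)`, up to a constant depending on `r`. A
-- vertex common to non-consecutive edges of the path makes the box empty, as the joints strictly
-- increase.

module Colouring where

  open import Algebra.Properties.CommutativeSemigroup using (interchange)
  open import Data.Bool.Base using (Bool; true; false; if_then_else_; _∧_; T)
  open import Data.Bool.Properties using (T?)
  open import Data.Fin.Base using (Fin; zero; suc; fromℕ<)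
  open import Data.Fin.Properties using (any?; all?; fromℕ<-injective)
  open import Data.Fin.Subset using (Subset; ∣_∣; _∩_; Nonempty; Empty; inside; outside; _∈_)
  open import Data.Fin.Subset.Properties using (_∈?_; nonempty?; x∈p∩q⁺; ∣⊥∣≡0; Empty-unique)
  open import Data.List.Base
    using (List; []; _∷_; map; filter; length; _++_; cartesianProductWith; cartesianProduct; upTo)
  open import Data.List.Membership.Propositional as List using (find; lose)
  open import Data.List.Membership.Propositional.Properties
  open import Data.List.Properties using (length-++; length-map; length-upTo; length-filter; map-++)
  open import Data.List.Relation.Unary.All as All using (All; []; _∷_)
  open import Data.List.Relation.Unary.Any as Any using (Any; here; there)
  open import Data.Nat.Base
  open import Data.Nat.DivMod using (_/_; m/n*n≤m; m≡m%n+[m/n]*n; m%n<n; /-monoˡ-≤; m*n/n≡m)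
  open import Data.Nat.ListAction using (sum)
  open import Data.Nat.ListAction.Properties using (sum-++)
  open import Data.Nat.Properties
  open import Data.Nat.Solver using (module +-*-Solver)
  open import Data.Product.Base using (∃₂; ∃-syntax; Σ-syntax; _×_; _,_; proj₁; proj₂; map₁)
  open import Data.Sum.Base using (_⊎_; inj₁; inj₂; reduce)
  open import Data.Unit.Base using (⊤; tt)
  open import Data.Vec.Base using ([]; _∷_; lookup; here; there)
  open import Data.Vec.Properties using (lookup-zipWith; []=⇒lookup; lookup⇒[]=)
  open import Defs using (Hypergraph)
  open import Function.Base using (_∘_; flip)
  open import Level using (0ℓ)
  open import Relation.Binary.Core using (Rel)
  open import Relation.Binary.Definitions using (Total; Transitive)
  open import Relation.Binary.PropositionalEquality hiding (J)
  open import Relation.Nullary using (¬_; Dec; yes; no; does; contradiction)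
  open import Relation.Nullary.Decidable using (map′; _×-dec_; _→-dec_)
  open import Relation.Unary using (Decidable)

  open Hypergraph using (order; edges; size; Uniform; Colorable)

  +-interchange = interchange +-commutativeSemigroup
  *-interchange = interchange *-commutativeSemigroup

  -- Finite sums, products and counts

  ∑< : ℕ → (ℕ → ℕ) → ℕ
  ∑< zero    f = 0
  ∑< (suc m) f = f m + ∑< m f

  ∑<-cong : ∀ m {f g} → (∀ t → f t ≡ g t) → ∑< m f ≡ ∑< m g
  ∑<-cong zero    f≗g = refl
  ∑<-cong (suc m) f≗g = cong₂ _+_ (f≗g m) (∑<-cong m f≗g)

  ∑<-mono : ∀ m {f g} → (∀ t → f t ≤ g t) → ∑< m f ≤ ∑< m g
  ∑<-mono zero    f≤g = z≤n
  ∑<-mono (suc m) f≤g = +-mono-≤ (f≤g m) (∑<-mono m f≤g)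

  ∑<-zero : ∀ m → ∑< m (λ _ → 0) ≡ 0
  ∑<-zero zero    = refl
  ∑<-zero (suc m) = ∑<-zero m

  ∑<-+ : ∀ m f g → ∑< m (λ t → f t + g t) ≡ ∑< m f + ∑< m g
  ∑<-+ zero    f g = refl
  ∑<-+ (suc m) f g = trans (cong (f m + g m +_) (∑<-+ m f g)) (+-interchange (f m) (g m) _ _)

  ∑<-*ʳ : ∀ m f c → ∑< m f * c ≡ ∑< m (λ t → f t * c)
  ∑<-*ʳ zero    f c = refl
  ∑<-*ʳ (suc m) f c = trans (*-distribʳ-+ c (f m) _) (cong (f m * c +_) (∑<-*ʳ m f c))

  ∑<-pigeonhole : ∀ m c f → ∑< m f < m * c → ∃[ t ] t < m × f t < c
  ∑<-pigeonhole (suc m) c f ∑<mc with f m <? c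
  ... | yes fm<c = m , ≤-refl , fm<c
  ... | no  fm≮c =
    let t , t<m , ft<c = ∑<-pigeonhole m c f
          (+-cancelˡ-< c _ _ (≤-<-trans (+-monoˡ-≤ _ (≮⇒≥ fm≮c)) ∑<mc))
    in t , m<n⇒m<1+n t<m , ft<c

  ∑ ∏ : ∀ {N} → (Fin N → ℕ) → ℕ
  ∑ {zero}  f = 0
  ∑ {suc N} f = f zero + ∑ (f ∘ suc)
  ∏ {zero}  f = 1
  ∏ {suc N} f = f zero * ∏ (f ∘ suc)

  ∑-mono : ∀ {N} {f g : Fin N → ℕ} → (∀ v → f v ≤ g v) → ∑ f ≤ ∑ g
  ∑-mono {zero}  f≤g = z≤n
  ∑-mono {suc N} f≤g = +-mono-≤ (f≤g zero) (∑-mono (f≤g ∘ suc))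

  ∑-+ : ∀ {N} (f g : Fin N → ℕ) → ∑ (λ v → f v + g v) ≡ ∑ f + ∑ g
  ∑-+ {zero}  f g = refl
  ∑-+ {suc N} f g = trans (cong (f zero + g zero +_) (∑-+ (f ∘ suc) (g ∘ suc)))
    (+-interchange (f zero) (g zero) _ _)

  ∑-zero : ∀ N → ∑ {N} (λ _ → 0) ≡ 0
  ∑-zero zero    = refl
  ∑-zero (suc N) = ∑-zero N

  ∏-mono : ∀ {N} {f g : Fin N → ℕ} → (∀ v → f v ≤ g v) → ∏ f ≤ ∏ g
  ∏-mono {zero}  f≤g = ≤-refl
  ∏-mono {suc N} f≤g = *-mono-≤ (f≤g zero) (∏-mono (f≤g ∘ suc))

  ∏-* : ∀ {N} (f g : Fin N → ℕ) → ∏ (λ v → f v * g v) ≡ ∏ f * ∏ g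
  ∏-* {zero}  f g = refl
  ∏-* {suc N} f g = trans (cong (f zero * g zero *_) (∏-* (f ∘ suc) (g ∘ suc)))
    (*-interchange (f zero) (g zero) _ _)

  ∏-const : ∀ N c → ∏ {N} (λ _ → c) ≡ c ^ N
  ∏-const zero    c = refl
  ∏-const (suc N) c = cong (c *_) (∏-const N c)

  ∏-^ : ∀ {N} c (f : Fin N → ℕ) → ∏ (λ v → c ^ f v) ≡ c ^ ∑ f
  ∏-^ {zero}  c f = refl
  ∏-^ {suc N} c f = trans (cong (c ^ f zero *_) (∏-^ c (f ∘ suc))) (sym (^-distribˡ-+-* c (f zero) _))

  ind : Bool → ℕ
  ind b = if b then 1 else 0

  count : ∀ {P : ℕ → Set} → ℕ → Decidable P → ℕ
  count m P? = ∑< m (ind ∘ does ∘ P?)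

  -- Weights avoiding a family of boxes

  -- Divided by `m ^ N`, this is the probability that independent uniform weights below `m` satisfy
  -- `P v` at every vertex `v`.
  volume : ∀ {N} {P : Fin N → ℕ → Set} → ℕ → (∀ v → Decidable (P v)) → ℕ
  volume m P? = ∏ (λ v → count m (P? v))

  module _ {A : Set} where

    -- Double counting of the pairs of a box and a value that it allows at one vertex: the form in
    -- which `avoid` conditions on that value.
    sum-count : ∀ m {P : A → ℕ → Set} (P? : ∀ a t → Dec (P a t)) (f : A → ℕ) as →
                sum (map (λ a → count m (P? a) * f a) as) ≡
                ∑< m (λ t → sum (map f (filter (λ a → P? a t) as)))
    sum-count m P? f []       = sym (∑<-zero m)
    sum-count m P? f (a ∷ as) = begin
      count m (P? a) * f a + sum (map (λ a → count m (P? a) * f a) as)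
        ≡⟨ cong₂ _+_ (∑<-*ʳ m _ (f a)) (sum-count m P? f as) ⟩
      ∑< m (λ t → ind (does (P? a t)) * f a) + ∑< m (λ t → sum (map f (filter (λ a → P? a t) as)))
        ≡⟨ ∑<-+ m _ _ ⟨
      ∑< m (λ t → ind (does (P? a t)) * f a + sum (map f (filter (λ a → P? a t) as)))
        ≡⟨ ∑<-cong m step ⟩
      ∑< m (λ t → sum (map f (filter (λ a → P? a t) (a ∷ as)))) ∎
      where
      open ≡-Reasoning
      step : ∀ t → ind (does (P? a t)) * f a + sum (map f (filter (λ a → P? a t) as)) ≡
                   sum (map f (filter (λ a → P? a t) (a ∷ as)))
      step t with does (P? a t)
      ... | true  = cong (_+ sum (map f (filter (λ a → P? a t) as))) (+-identityʳ (f a))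
      ... | false = refl

    -- The weights are fixed one vertex at a time; by averaging, some value keeps
    -- the total volume of the boxes that are still possible below m ^ N.
    avoid : ∀ m {N} {P : A → Fin N → ℕ → Set} (P? : ∀ a v → Decidable (P a v)) as →
            sum (map (λ a → volume m (P? a)) as) < m ^ N →
            Σ[ w ∈ (Fin N → ℕ) ] (∀ v → w v < m) × (∀ {a} → a List.∈ as → ¬ (∀ v → P a v (w v)))
    avoid m {zero} P? []      _         = (λ ()) , (λ ()) , λ ()
    avoid m {zero} P? (a ∷ as) (s≤s ())
    avoid m {suc N} {P} P? as sum<m^N =
      let rest = λ a → volume m (P? a ∘ suc)
          t , t<m , sum<   = ∑<-pigeonhole m (m ^ N) _
                               (subst (_< m ^ suc N) (sum-count m (λ a → P? a zero) rest as) sum<m^N)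
          w , w<m , avoids = avoid m (λ a v → P? a (suc v)) (filter (λ a → P? a zero t) as) sum<
      in (λ { zero → t ; (suc v) → w v }) ,
         (λ { zero → t<m ; (suc v) → w<m v }) ,
         (λ a∈as all → avoids (∈-filter⁺ (λ a → P? a zero t) a∈as (all zero)) (all ∘ suc))

    -- The union bound without division. With `c = 4` it gives each of the two families of boxes at
    -- most a quarter of all weightings.
    sum-≤ : ∀ c l X (f : A → ℕ) as → length as ≤ l →
            (∀ {a} → a List.∈ as → c * l * f a ≤ X) → c * sum (map f as) ≤ X
    sum-≤ c l X f []           _    _   = ≤-trans (≤-reflexive (*-zeroʳ c)) z≤n
    sum-≤ c l@(suc _) X f as@(_ ∷ _) ∣as∣≤l f≤X = *-cancelˡ-≤ l (begin
      l * (c * sum (map f as))  ≡⟨ solve 3 (λ l c s → l :* (c :* s) := c :* l :* s) refl l c (sum (map f as)) ⟩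
      c * l * sum (map f as)    ≤⟨ total as f≤X ⟩
      length as * X             ≤⟨ *-monoˡ-≤ X ∣as∣≤l ⟩
      l * X                     ∎)
      where
      open ≤-Reasoning
      open +-*-Solver
      total : ∀ bs → (∀ {a} → a List.∈ bs → c * l * f a ≤ X) → c * l * sum (map f bs) ≤ length bs * X
      total []       _ = ≤-reflexive (*-zeroʳ (c * l))
      total (b ∷ bs) h = ≤-trans (≤-reflexive (*-distribˡ-+ (c * l) (f b) _))
                                 (+-mono-≤ (h (here refl)) (total bs (h ∘ there)))

  -- Volume of the box of a chain of edges

  module _ {P : ℕ → Set} (P? : Decidable P) where

    count-≥ : ∀ m {x} → (∀ t → P t → x ≤ t) → count m P? ≤ m ∸ x
    count-≥ zero        _   = z≤n
    count-≥ (suc m) {x} x≤P with P? m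
    ... | yes p = ≤-trans (s≤s (count-≥ m x≤P)) (≤-reflexive (sym (+-∸-assoc 1 (x≤P m p))))
    ... | no  _ = ≤-trans (count-≥ m x≤P) (∸-monoˡ-≤ x (n≤1+n m))

    count-interval : ∀ m {x y} → (∀ t → P t → x ≤ t × t ≤ y) → count m P? ≤ suc y ∸ x
    count-interval zero        _    = z≤n
    count-interval (suc m) {x} P⊆xy with P? m | count-≥ (suc m) (λ t → proj₁ ∘ P⊆xy t)
    ... | yes p | bound = ≤-trans bound (∸-monoˡ-≤ x (s≤s (proj₂ (P⊆xy m p))))
    ... | no  _ | _     = count-interval m P⊆xy

  count-mono : ∀ m {P Q : ℕ → Set} (P? : Decidable P) (Q? : Decidable Q) →
               (∀ t → P t → Q t) → count m P? ≤ count m Q?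
  count-mono m P? Q? P⊆Q = ∑<-mono m step
    where
    step : ∀ t → ind (does (P? t)) ≤ ind (does (Q? t))
    step t with P? t | Q? t
    ... | no  _ | _      = z≤n
    ... | yes p | yes _  = ≤-refl
    ... | yes p | no ¬q  = contradiction (P⊆Q t p) ¬q

  -- A list (b₁ , y₁) ∷ (b₂ , y₂) ∷ ⋯ together with a starting point y₀ stands for
  -- the intervals [y₀ , y₁], [y₁ , y₂], …; the i-th one constrains a weight only
  -- if bᵢ holds.

  Fits : ℕ → List (Bool × ℕ) → ℕ → Set
  Fits x []             t = ⊤
  Fits x ((b , y) ∷ cs) t = (T b → x ≤ t × t ≤ y) × Fits y cs t

  fits? : ∀ x cs → Decidable (Fits x cs)
  fits? x []             t = yes tt
  fits? x ((b , y) ∷ cs) t = (T? b →-dec ((x ≤? t) ×-dec (t ≤? y))) ×-dec fits? y cs t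

  module _ {A : Set} where

    -- An interval from `x` to `y` has `suc y ∸ x` values, so this asks for at least `B` of them; an
    -- interval of exactly `B` values qualifies, as `shortBox` requires.
    Spaced : ℕ → ℕ → List (A × ℕ) → Set
    Spaced B x []             = ⊤
    Spaced B x ((_ , y) ∷ cs) = x + B ≤ suc y × Spaced B y cs

    spaced? : ∀ B x cs → Dec (Spaced B x cs)
    spaced? B x []             = yes tt
    spaced? B x ((_ , y) ∷ cs) = (x + B ≤? suc y) ×-dec spaced? B y cs

    widths widthSum : ℕ → List (A × ℕ) → ℕ
    widths x []             = 1
    widths x ((_ , y) ∷ cs) = (suc y ∸ x) * widths y cs
    widthSum x []             = 0
    widthSum x ((_ , y) ∷ cs) = (suc y ∸ x) + widthSum y cs

  Spaced-map : ∀ {A A′ : Set} (f : A → A′) {B} x cs → Spaced B x cs → Spaced B x (map (map₁ f) cs)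
  Spaced-map f x []             _             = tt
  Spaced-map f x ((_ , y) ∷ cs) (x+B≤y , sp) = x+B≤y , Spaced-map f y cs sp

  -- For the column of a vertex, `trues` is the number of edges of the chain containing it, and
  -- `adjacent` the number of consecutive pairs whose two edges both contain it.
  trues adjacent : List (Bool × ℕ) → ℕ
  headTrue : List (Bool × ℕ) → Bool

  trues []             = 0
  trues ((b , _) ∷ cs) = ind b + trues cs

  headTrue []            = false
  headTrue ((b , _) ∷ _) = b

  adjacent []             = 0
  adjacent ((b , _) ∷ cs) = ind (b ∧ headTrue cs) + adjacent cs

  activeWidths : ℕ → List (Bool × ℕ) → ℕ
  activeWidths x []             = 1
  activeWidths x ((b , y) ∷ cs) = (suc y ∸ x) ^ ind b * activeWidths y cs

  trues≡0 : ∀ x cs → trues cs ≡ 0 → headTrue cs ≡ false × adjacent cs ≡ 0 × activeWidths x cs ≡ 1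
  trues≡0 x []                 _  = refl , refl , refl
  trues≡0 x ((false , y) ∷ cs) eq = let _ , a , w = trues≡0 y cs eq in
    refl , a , trans (+-identityʳ _) w

  module _ (M B : ℕ) (2≤B : 2 ≤ B) where

    x<y : ∀ {x y} → x + B ≤ suc y → x < y
    x<y {x} x+B≤y = s≤s⁻¹ (≤-trans (≤-reflexive (+-comm 2 x)) (≤-trans (+-monoʳ-≤ x 2≤B) x+B≤y))

    B≤width : ∀ {x y} → x + B ≤ suc y → B ≤ suc y ∸ x
    B≤width {x} x+B≤y = ≤-trans (≤-reflexive (sym (m+n∸m≡n x B))) (∸-monoˡ-≤ x x+B≤y)

    Fits-≥ : ∀ x cs → Spaced B x cs → trues cs ≢ 0 → ∀ t → Fits x cs t → x ≤ t
    Fits-≥ x []                 _        ≢0 t _       = contradiction refl ≢0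
    Fits-≥ x ((true  , y) ∷ cs) _        _  t (f , _) = proj₁ (f tt)
    Fits-≥ x ((false , y) ∷ cs) (g , sp) ≢0 t (_ , f) = ≤-trans (<⇒≤ (x<y g)) (Fits-≥ y cs sp ≢0 t f)

    vanish : ∀ {c y y′ a b d} → y < y′ → c ≤ suc y ∸ y′ → c * a * b ≤ d
    vanish {a = a} {b} {d} y<y′ c≤ with ≤-trans c≤ (≤-reflexive (m≤n⇒m∸n≡0 y<y′))
    ... | z≤n = z≤n

    -- A weight constrained by two adjacent intervals is their common endpoint,
    -- and no weight is constrained by two other intervals.
    count-fits : ∀ x cs → Spaced B x cs →
                 count M (fits? x cs) * M ^ trues cs * (B * B) ^ adjacent cs ≤
                 M * activeWidths x cs * M ^ adjacent cs
    count-fits x [] _ = *-monoˡ-≤ 1 (*-monoˡ-≤ 1 (count-≥ (fits? x []) M (λ _ _ → z≤n)))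
    count-fits x ((false , y) ∷ cs) (_ , sp) = begin
      count M (fits? x ((false , y) ∷ cs)) * M ^ trues cs * (B * B) ^ adjacent cs
        ≤⟨ *-monoˡ-≤ ((B * B) ^ adjacent cs) (*-monoˡ-≤ (M ^ trues cs)
             (count-mono M (fits? x ((false , y) ∷ cs)) (fits? y cs) (λ _ → proj₂))) ⟩
      count M (fits? y cs) * M ^ trues cs * (B * B) ^ adjacent cs
        ≤⟨ count-fits y cs sp ⟩
      M * activeWidths y cs * M ^ adjacent cs
        ≡⟨ cong (λ w → M * w * M ^ adjacent cs) (+-identityʳ (activeWidths y cs)) ⟨
      M * (1 * activeWidths y cs) * M ^ adjacent cs ∎
      where open ≤-Reasoning
    count-fits x ((true , y) ∷ cs) (g , sp) with trues cs ≟ 0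
    ... | yes none with trues cs | headTrue cs | adjacent cs | activeWidths y cs
                      | none | trues≡0 y cs none
    ...   | _ | _ | _ | _ | refl | refl , refl , refl = *-monoˡ-≤ 1 (begin
      count M (fits? x ((true , y) ∷ cs)) * (M * 1)
        ≤⟨ *-monoˡ-≤ (M * 1) (count-interval (fits? x ((true , y) ∷ cs)) M (λ _ f → proj₁ f tt)) ⟩
      (suc y ∸ x) * (M * 1)
        ≡⟨ solve 2 (λ w m → w :* (m :* con 1) := m :* (w :* con 1 :* con 1)) refl (suc y ∸ x) M ⟩
      M * ((suc y ∸ x) * 1 * 1) ∎)
      where
      open ≤-Reasoning
      open +-*-Solver
    count-fits x ((true , y) ∷ []) _ | no some = contradiction refl some
    count-fits x ((true , y) ∷ (false , y′) ∷ cs) (_ , g , sp) | no some =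
      vanish (x<y g) (count-interval (fits? x ((true , y) ∷ (false , y′) ∷ cs)) M
        (λ t (f , _ , f′) → Fits-≥ y′ cs sp some t f′ , proj₂ (f tt)))
    count-fits x ((true , y) ∷ (true , y′) ∷ cs) (g , g′ , sp) | no some with trues cs ≟ 0
    ... | no some′ =
      vanish (x<y g′) (count-interval (fits? x ((true , y) ∷ (true , y′) ∷ cs)) M
        (λ t (f , _ , f′) → Fits-≥ y′ cs sp some′ t f′ , proj₂ (f tt)))
    ... | yes none with trues cs | headTrue cs | adjacent cs | activeWidths y′ cs
                      | none | trues≡0 y′ cs none
    ...   | _ | _ | _ | _ | refl | refl , refl , refl = begin
      count M (fits? x ((true , y) ∷ (true , y′) ∷ cs)) * (M * (M * 1)) * (B * B * 1)
        -- Only the common endpoint `y` remains, so the count is at most 1 and both widths on the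
        -- right are spare: each is at least `B`, and together they pay for `B * B`.
        ≤⟨ *-mono-≤ (*-monoˡ-≤ (M * (M * 1)) (≤-trans
             (count-interval (fits? x ((true , y) ∷ (true , y′) ∷ cs)) M
               (λ t (f , f′ , _) → proj₁ (f′ tt) , proj₂ (f tt)))
             (≤-reflexive (m+n∸n≡m 1 y))))
             (*-monoˡ-≤ 1 (*-mono-≤ (B≤width g) (B≤width g′))) ⟩
      1 * (M * (M * 1)) * ((suc y ∸ x) * (suc y′ ∸ y) * 1)
        ≡⟨ solve 3 (λ m w w′ → con 1 :* (m :* (m :* con 1)) :* (w :* w′ :* con 1) :=
             m :* (w :* con 1 :* (w′ :* con 1 :* con 1)) :* (m :* con 1)) refl M (suc y ∸ x) (suc y′ ∸ y) ⟩
      M * ((suc y ∸ x) * 1 * ((suc y′ ∸ y) * 1 * 1)) * (M * 1) ∎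
      where
      open ≤-Reasoning
      open +-*-Solver

  column : ∀ {N} → Fin N → List (Subset N × ℕ) → List (Bool × ℕ)
  column v = map (map₁ (λ e → lookup e v))

  ∑-lookup : ∀ {N} (e : Subset N) → ∑ (λ v → ind (lookup e v)) ≡ ∣ e ∣
  ∑-lookup []            = refl
  ∑-lookup (outside ∷ e) = ∑-lookup e
  ∑-lookup (inside ∷ e)  = cong suc (∑-lookup e)

  ∑-≥ : ∀ {N} (f : Fin N → ℕ) v → f v ≤ ∑ f
  ∑-≥ f zero    = m≤m+n _ _
  ∑-≥ f (suc v) = ≤-trans (∑-≥ (f ∘ suc) v) (m≤n+m _ _)

  HasSize : ∀ {N} → ℕ → Subset N × ℕ → Set
  HasSize n (e , _) = ∣ e ∣ ≡ n

  ∑-trues : ∀ {N n} (cs : List (Subset N × ℕ)) → All (HasSize n) cs →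
            ∑ (λ v → trues (column v cs)) ≡ length cs * n
  ∑-trues {N} []             []         = ∑-zero N
  ∑-trues     ((e , _) ∷ cs) (≡n ∷ all) = trans (∑-+ (λ v → ind (lookup e v)) _)
    (cong₂ _+_ (trans (∑-lookup e) ≡n) (∑-trues cs all))

  ^-* : ∀ a b n → (a * b) ^ n ≡ a ^ n * b ^ n
  ^-* a b zero    = refl
  ^-* a b (suc n) = trans (cong (a * b *_) (^-* a b n)) (*-interchange a b _ _)

  ∏-activeWidths : ∀ {N n} x (cs : List (Subset N × ℕ)) → All (HasSize n) cs →
                   ∏ (λ v → activeWidths x (column v cs)) ≡ widths x cs ^ n
  ∏-activeWidths {N} {n} x []         []         = trans (∏-const N 1) (trans (^-zeroˡ N) (sym (^-zeroˡ n)))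
  ∏-activeWidths {n = n} x ((e , y) ∷ cs) (≡n ∷ all) = begin
    ∏ (λ v → (suc y ∸ x) ^ ind (lookup e v) * activeWidths y (column v cs))
      ≡⟨ ∏-* (λ v → (suc y ∸ x) ^ ind (lookup e v)) _ ⟩
    ∏ (λ v → (suc y ∸ x) ^ ind (lookup e v)) * ∏ (λ v → activeWidths y (column v cs))
      ≡⟨ cong₂ _*_ (∏-^ (suc y ∸ x) (λ v → ind (lookup e v))) (∏-activeWidths y cs all) ⟩
    (suc y ∸ x) ^ ∑ (λ v → ind (lookup e v)) * widths y cs ^ n
      ≡⟨ cong (λ k → (suc y ∸ x) ^ k * widths y cs ^ n) (trans (∑-lookup e) ≡n) ⟩
    (suc y ∸ x) ^ n * widths y cs ^ n
      ≡⟨ ^-* (suc y ∸ x) _ n ⟨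
    ((suc y ∸ x) * widths y cs) ^ n ∎
    where open ≡-Reasoning

  Meets : ∀ {N} → Subset N → List (Subset N × ℕ) → Set
  Meets e []             = ⊤
  Meets e ((e′ , _) ∷ _) = Nonempty (e ∩ e′)

  Linked : ∀ {N} → List (Subset N × ℕ) → Set
  Linked []             = ⊤
  Linked ((e , _) ∷ cs) = Meets e cs × Linked cs

  -- Every pair of consecutive edges has a common vertex, and that vertex contributes at least 1 to
  -- the sum.
  length≤∑-adjacent : ∀ {N} (cs : List (Subset N × ℕ)) → Linked cs →
                      length cs ≤ suc (∑ (λ v → adjacent (column v cs)))
  length≤∑-adjacent []                             _              = z≤n
  length≤∑-adjacent ((e , _) ∷ [])                 _              = s≤s z≤n
  length≤∑-adjacent ((e , _) ∷ cs@((e′ , _) ∷ _)) ((v , v∈) , l) = s≤s (begin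
    length cs                             ≤⟨ length≤∑-adjacent cs l ⟩
    1 + ∑ (λ u → adjacent (column u cs))  ≤⟨ +-monoˡ-≤ _ common ⟩
    ∑ (λ u → ind (lookup e u ∧ lookup e′ u)) + ∑ (λ u → adjacent (column u cs))
      ≡⟨ ∑-+ (λ u → ind (lookup e u ∧ lookup e′ u)) _ ⟨
    ∑ (λ u → adjacent (column u ((e , 0) ∷ cs))) ∎)
    where
    open ≤-Reasoning
    common : 1 ≤ ∑ (λ u → ind (lookup e u ∧ lookup e′ u))
    common = ≤-trans (≤-reflexive (cong ind (trans (sym ([]=⇒lookup v∈)) (lookup-zipWith _∧_ v e e′))))
                     (∑-≥ (λ u → ind (lookup e u ∧ lookup e′ u)) v)

  module _ (M B : ℕ) .{{_ : NonZero M}} (2≤B : 2 ≤ B) (M≤B² : M ≤ B * B) where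

    -- The product of `count-fits` over all vertices. Relative to `M ^ N`, the box has measure at
    -- most `(widths / M ^ length) ^ n`, the value for disjoint edges, times one factor `M / B²` for
    -- each joint.
    box-volume : ∀ {N n} x (cs : List (Subset N × ℕ)) → Spaced B x cs → Linked cs → All (HasSize n) cs →
                 volume M (λ v → fits? x (column v cs)) * M ^ (length cs * n) * (B * B) ^ (length cs ∸ 1) ≤
                 M ^ N * widths x cs ^ n * M ^ (length cs ∸ 1)
    box-volume {N} {n} x cs spaced linked sized = lower-exponent
      (volume M fits * M ^ (length cs * n)) (M ^ N * widths x cs ^ n) (length cs ∸ 1) (∑ J)
      (∸-monoˡ-≤ 1 (length≤∑-adjacent cs linked)) (begin
        volume M fits * M ^ (length cs * n) * (B * B) ^ ∑ J
          ≡⟨ cong (λ k → volume M fits * M ^ k * (B * B) ^ ∑ J) (∑-trues cs sized) ⟨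
        volume M fits * M ^ ∑ K * (B * B) ^ ∑ J
          ≡⟨ cong₂ (λ a b → volume M fits * a * b) (∏-^ M K) (∏-^ (B * B) J) ⟨
        volume M fits * ∏ (λ v → M ^ K v) * ∏ (λ v → (B * B) ^ J v)
          ≡⟨ cong (_* ∏ (λ v → (B * B) ^ J v)) (∏-* _ (λ v → M ^ K v)) ⟨
        ∏ (λ v → count M (fits v) * M ^ K v) * ∏ (λ v → (B * B) ^ J v)
          ≡⟨ ∏-* _ (λ v → (B * B) ^ J v) ⟨
        ∏ (λ v → count M (fits v) * M ^ K v * (B * B) ^ J v)
          ≤⟨ ∏-mono (λ v → count-fits M B 2≤B x (column v cs) (Spaced-map (λ e → lookup e v) x cs spaced)) ⟩
        ∏ (λ v → M * W v * M ^ J v)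
          ≡⟨ ∏-* (λ v → M * W v) _ ⟩
        ∏ (λ v → M * W v) * ∏ (λ v → M ^ J v)
          ≡⟨ cong₂ _*_ (∏-* (λ _ → M) W) (∏-^ M J) ⟩
        ∏ {N} (λ _ → M) * ∏ W * M ^ ∑ J
          ≡⟨ cong₂ (λ a b → a * b * M ^ ∑ J) (∏-const N M) (∏-activeWidths x cs sized) ⟩
        M ^ N * widths x cs ^ n * M ^ ∑ J ∎)
      where
      open ≤-Reasoning
      fits : ∀ v → Decidable (Fits x (column v cs))
      fits v = fits? x (column v cs)
      K J W : Fin N → ℕ
      K v = trues (column v cs)
      J v = adjacent (column v cs)
      W v = activeWidths x (column v cs)

      lower-exponent : ∀ a c i j → i ≤ j → a * (B * B) ^ j ≤ c * M ^ j → a * (B * B) ^ i ≤ c * M ^ i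
      lower-exponent a c i j i≤j ≤j = *-cancelʳ-≤ _ _ (M ^ (j ∸ i)) {{m^n≢0 M (j ∸ i)}} (begin
        a * (B * B) ^ i * M ^ (j ∸ i)        ≤⟨ *-monoʳ-≤ (a * (B * B) ^ i) (^-monoˡ-≤ (j ∸ i) M≤B²) ⟩
        a * (B * B) ^ i * (B * B) ^ (j ∸ i)  ≡⟨ join a (B * B) ⟩
        a * (B * B) ^ j                      ≤⟨ ≤j ⟩
        c * M ^ j                            ≡⟨ join c M ⟨
        c * M ^ i * M ^ (j ∸ i)              ∎)
        where
        join : ∀ a b → a * b ^ i * b ^ (j ∸ i) ≡ a * b ^ j
        join a b = trans (*-assoc a _ _) (cong (a *_) (trans (sym (^-distribˡ-+-* b i (j ∸ i)))
                                                             (cong (b ^_) (m+[n∸m]≡n i≤j))))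

  -- The inequality of arithmetic and geometric means in ℕ

  2xy≤x²+y² : ∀ x y → 2 * (x * y) ≤ x * x + y * y
  2xy≤x²+y² x y with ≤-total x y
  ... | inj₁ x≤y = subst (λ y → 2 * (x * y) ≤ x * x + y * y) (m+[n∸m]≡n x≤y) (≤-trans (m≤m+n _ (d * d))
          (≤-reflexive (solve 2 (λ x d → con 2 :* (x :* (x :+ d)) :+ d :* d
               := x :* x :+ (x :+ d) :* (x :+ d)) refl x d)))
    where
    open +-*-Solver
    d = y ∸ x
  ... | inj₂ y≤x = subst (λ x → 2 * (x * y) ≤ x * x + y * y) (m+[n∸m]≡n y≤x) (≤-trans (m≤m+n _ (d * d))
          (≤-reflexive (solve 2 (λ y d → con 2 :* ((y :+ d) :* y) :+ d :* d
               := (y :+ d) :* (y :+ d) :+ y :* y) refl y d)))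
    where
    open +-*-Solver
    d = x ∸ y

  -- Induction: add `z` times the inequality for `k` to `suc k * y ^ k` times `2xy≤x²+y²`. Terms
  -- that would be subtracted are added to both sides and cancelled.
  young : ∀ k z y → suc k * (z * y ^ k) ≤ z ^ suc k + k * y ^ suc k
  young zero    z y = ≤-reflexive (solve 1 (λ z → con 1 :* (z :* con 1) := z :* con 1 :+ con 0) refl z)
    where open +-*-Solver
  young (suc k) z y = +-cancelʳ-≤ (k * (z * (y * Y)) + suc k * (z * z * Y)) _ _ (begin
    suc (suc k) * (z * (y * Y)) + (k * (z * (y * Y)) + suc k * (z * z * Y))
      ≡⟨ solve 4 (λ k z y Y → (con 2 :+ k) :* (z :* (y :* Y)) :+ (k :* (z :* (y :* Y)) :+ (con 1 :+ k) :* (z :* z :* Y))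
           := (con 2 :* (z :* y)) :* ((con 1 :+ k) :* Y) :+ z :* ((con 1 :+ k) :* (z :* Y))) refl k z y Y ⟩
    2 * (z * y) * (suc k * Y) + z * (suc k * (z * Y))
      ≤⟨ +-mono-≤ (*-monoˡ-≤ (suc k * Y) (2xy≤x²+y² z y)) (*-monoʳ-≤ z (young k z y)) ⟩
    (z * z + y * y) * (suc k * Y) + z * (z * Z + k * (y * Y))
      ≡⟨ solve 5 (λ k z y Y Z → (z :* z :+ y :* y) :* ((con 1 :+ k) :* Y) :+ z :* (z :* Z :+ k :* (y :* Y))
           := z :* (z :* Z) :+ (con 1 :+ k) :* (y :* (y :* Y)) :+ (k :* (z :* (y :* Y)) :+ (con 1 :+ k) :* (z :* z :* Y))) refl k z y Y Z ⟩
    z * (z * Z) + suc k * (y * (y * Y)) + (k * (z * (y * Y)) + suc k * (z * z * Y)) ∎)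
    where
    open ≤-Reasoning
    open +-*-Solver
    Y = y ^ k
    Z = z ^ k

  -- Young's inequality for k (a + s) and (k + 1) s.
  weighted-am-gm : ∀ k a s → suc k ^ suc k * (a * s ^ k) ≤ k ^ k * (a + s) ^ suc k
  weighted-am-gm zero      a s = ≤-trans (≤-reflexive (solve 1 (λ a → con 1 :* (a :* con 1) := a) refl a))
    (≤-trans (m≤m+n a s) (≤-reflexive (solve 2 (λ a s → a :+ s := con 1 :* ((a :+ s) :* con 1)) refl a s)))
    where open +-*-Solver
  weighted-am-gm k@(suc _) a s = *-cancelˡ-≤ k (begin
    k * (suc k * K * (a * S))
      ≡⟨ solve 4 (λ k K a S → k :* ((con 1 :+ k) :* K :* (a :* S))
           := (con 1 :+ k) :* k :* a :* (K :* S)) refl k K a S ⟩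
    suc k * k * a * (K * S)
      ≡⟨ cong (suc k * k * a *_) (^-* (suc k) s k) ⟨
    suc k * k * a * Y ^ k
      ≤⟨ +-cancelʳ-≤ (k * Y ^ suc k) _ _ (≤-trans (≤-reflexive
           (solve 4 (λ k a s Yk → (con 1 :+ k) :* k :* a :* Yk :+ k :* ((con 1 :+ k) :* s :* Yk)
                := (con 1 :+ k) :* (k :* (a :+ s) :* Yk)) refl k a s (Y ^ k)))
           (young k Z Y)) ⟩
    Z ^ suc k
      ≡⟨ ^-* k (a + s) (suc k) ⟩
    k * k ^ k * (a + s) ^ suc k
      ≡⟨ *-assoc k (k ^ k) _ ⟩
    k * (k ^ k * (a + s) ^ suc k) ∎)
    where
    open ≤-Reasoning
    open +-*-Solver
    K = suc k ^ k
    S = s ^ k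
    Y = suc k * s
    Z = k * (a + s)

  -- Split off the first width and use `weighted-am-gm` for it against the sum of the others. The
  -- cancelled factor `k ^ k` is nonzero even for `k = 0`, where it is 1.
  am-gm : ∀ {A : Set} x (cs : List (A × ℕ)) → length cs ^ length cs * widths x cs ≤ widthSum x cs ^ length cs
  am-gm x []             = ≤-refl
  am-gm x ((_ , y) ∷ cs) = *-cancelˡ-≤ (k ^ k) {{k^k≢0 k}} (begin
    k ^ k * (suc k ^ suc k * (a * widths y cs))
      ≡⟨ solve 4 (λ K L a W → K :* (L :* (a :* W))
           := L :* (a :* (K :* W))) refl (k ^ k) (suc k ^ suc k) a (widths y cs) ⟩
    suc k ^ suc k * (a * (k ^ k * widths y cs))
      ≤⟨ *-monoʳ-≤ (suc k ^ suc k) (*-monoʳ-≤ a (am-gm y cs)) ⟩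
    suc k ^ suc k * (a * widthSum y cs ^ k)
      ≤⟨ weighted-am-gm k a (widthSum y cs) ⟩
    k ^ k * (a + widthSum y cs) ^ suc k ∎)
    where
    open ≤-Reasoning
    open +-*-Solver
    k = length cs
    a = suc y ∸ x
    k^k≢0 : ∀ k → NonZero (k ^ k)
    k^k≢0 zero    = nonZero
    k^k≢0 (suc k) = m^n≢0 (suc k) (suc k)

  -- Longest paths

  extremum : ∀ {_≼_ : Rel ℕ 0ℓ} → Total _≼_ → Transitive _≼_ → ∀ {N} (w : Fin N → ℕ) e →
             Empty e ⊎ ∃[ v ] v ∈ e × (∀ u → u ∈ e → w v ≼ w u)
  extremum total ≼-trans w [] = inj₁ λ ()
  extremum total ≼-trans w (b ∷ e) with b | extremum total ≼-trans (w ∘ suc) e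
  ... | outside | inj₁ empty          = inj₁ λ { (suc v , there v∈) → empty (v , v∈) }
  ... | outside | inj₂ (v , v∈ , ext) = inj₂ (suc v , there v∈ , λ { (suc u) (there u∈) → ext u u∈ })
  ... | inside  | inj₁ empty          = inj₂ (zero , here , λ
    { zero    _          → reduce (total _ _)
    ; (suc u) (there u∈) → contradiction (u , u∈) empty })
  ... | inside  | inj₂ (v , v∈ , ext) with total (w zero) (w (suc v))
  ...   | inj₁ ≼ = inj₂ (zero , here , λ
    { zero    _          → reduce (total _ _)
    ; (suc u) (there u∈) → ≼-trans ≼ (ext u u∈) })
  ...   | inj₂ ≼ = inj₂ (suc v , there v∈ , λ { zero _ → ≼ ; (suc u) (there u∈) → ext u u∈ })

  module _ {N : ℕ} (w : Fin N → ℕ) (es : List (Subset N)) where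

    Arc : Subset N → Fin N → Fin N → Set
    Arc e v u = v ∈ e × u ∈ e × (∀ x → x ∈ e → w v ≤ w x × w x ≤ w u)

    arc? : ∀ e v u → Dec (Arc e v u)
    arc? e v u = (v ∈? e) ×-dec (u ∈? e) ×-dec
      all? (λ x → (x ∈? e) →-dec ((w v ≤? w x) ×-dec (w x ≤? w u)))

    arc : ∀ {e} → Nonempty e → ∃₂ (Arc e)
    arc {e} nonempty with extremum ≤-total ≤-trans w e | extremum (flip ≤-total) (flip ≤-trans) w e
    ... | inj₁ empty        | _                 = contradiction nonempty empty
    ... | _                 | inj₁ empty        = contradiction nonempty empty
    ... | inj₂ (v , v∈ , lo) | inj₂ (u , u∈ , hi) = v , u , v∈ , u∈ , λ x x∈ → lo x x∈ , hi x x∈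

    Path : ℕ → Fin N → Set
    Path zero    v = ⊤
    Path (suc j) v = ∃[ u ] Any (λ e → Arc e v u) es × Path j u

    path? : ∀ j v → Dec (Path j v)
    path? zero    v = yes tt
    path? (suc j) v = any? (λ u → Any.any? (λ e → arc? e v u) es ×-dec path? j u)

    -- The colouring of the Gallai-Roy theorem: the length of a longest path from `v`. The cap `j`
    -- keeps it well defined before cycles of arcs, which carry paths of every length, are excluded.
    height : ℕ → Fin N → ℕ
    height zero    v = 0
    height (suc j) v with path? (suc j) v
    ... | yes _ = suc j
    ... | no  _ = height j v

    height≤ : ∀ j v → height j v ≤ j
    height≤ zero    v = z≤n
    height≤ (suc j) v with path? (suc j) v
    ... | yes _ = ≤-refl
    ... | no  _ = m≤n⇒m≤1+n (height≤ j v)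

    height-path : ∀ j v → Path (height j v) v
    height-path zero    v = tt
    height-path (suc j) v with path? (suc j) v
    ... | yes p = p
    ... | no  _ = height-path j v

    height-max : ∀ j v {i} → i ≤ j → Path i v → i ≤ height j v
    height-max zero    v i≤0 _ = i≤0
    height-max (suc j) v i≤1+j p with path? (suc j) v
    ... | yes _ = i≤1+j
    ... | no ¬p = height-max j v (s≤s⁻¹ (≤∧≢⇒< i≤1+j λ { refl → ¬p p })) p

    -- The length of a longest path decreases along an arc.
    height-arc : ∀ ρ → (∀ v → ¬ Path (suc ρ) v) →
                 ∀ {e v u} → e List.∈ es → Arc e v u → height ρ v ≢ height ρ u
    height-arc ρ ¬path {e} {v} {u} e∈ a hv≡hu = contradiction
      (height-max ρ v (≤∧≢⇒< (height≤ ρ u) hu≢ρ) path)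
      (<⇒≱ (s≤s (≤-reflexive hv≡hu)))
      where
      path : Path (suc (height ρ u)) v
      path = u , lose e∈ a , height-path ρ u
      hu≢ρ : height ρ u ≢ ρ
      hu≢ρ hu≡ρ = ¬path v (subst (λ j → Path (suc j) v) hu≡ρ path)

  colourable : (H : Hypergraph) (w : Fin (order H) → ℕ) → All Nonempty (edges H) →
               ∀ ρ → (∀ v → ¬ Path w (edges H) (suc ρ) v) → Colorable H (suc ρ)
  colourable H w nonempty ρ ¬path = (λ v → fromℕ< (s≤s (height≤ w (edges H) ρ v))) ,
    All.tabulate λ e∈ → let v , u , a@(v∈ , u∈ , _) = arc w (edges H) (All.lookup nonempty e∈) in
      v , u , v∈ , u∈ , λ eq → height-arc w (edges H) ρ ¬path e∈ a (fromℕ<-injective _ _ _ _ eq)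

  -- Enumeration of the boxes of long paths

  length-cartesianProductWith : ∀ {A B C : Set} (f : A → B → C) xs ys →
                                length (cartesianProductWith f xs ys) ≡ length xs * length ys
  length-cartesianProductWith f []       ys = refl
  length-cartesianProductWith f (x ∷ xs) ys = trans (length-++ (map (f x) ys))
    (cong₂ _+_ (length-map (f x) ys) (length-cartesianProductWith f xs ys))

  T⇒∈ : ∀ {N} (v : Fin N) (e : Subset N) → T (lookup e v) → v ∈ e
  T⇒∈ v e t = lookup⇒[]= v e (T⇒≡true t)
    where
    T⇒≡true : ∀ {b} → T b → b ≡ true
    T⇒≡true {true} _ = refl

  linked? : ∀ {N} (cs : List (Subset N × ℕ)) → Dec (Linked cs)
  linked? []             = yes tt
  linked? ((e , _) ∷ cs) = meets? cs ×-dec linked? cs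
    where
    meets? : ∀ cs → Dec (Meets e cs)
    meets? []             = yes tt
    meets? ((e′ , _) ∷ _) = nonempty? (e ∩ e′)

  module _ {N : ℕ} (es : List (Subset N)) (n ρ B T M : ℕ) where

    -- In a path of j + 1 edges whose first vertex has weight at least lo, and where
    -- lo + (j + 1) B + T = M, the weights of the joints are confined to windows of T
    -- values each.
    chains : ℕ → ℕ → List (List (Subset N × ℕ))
    chains lo zero    = map (λ e → (e , pred M) ∷ []) es
    chains lo (suc j) = cartesianProductWith (λ (e , t) cs → (e , lo + B + t) ∷ cs)
      (cartesianProduct es (upTo T)) (chains (lo + B) j)

    length-chains : ∀ lo j → length (chains lo j) ≡ (length es * T) ^ j * length es
    length-chains lo zero    = trans (length-map _ es) (sym (+-identityʳ _))
    length-chains lo (suc j) = begin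
      length (chains lo (suc j))
        ≡⟨ length-cartesianProductWith _ (cartesianProduct es (upTo T)) _ ⟩
      length (cartesianProduct es (upTo T)) * length (chains (lo + B) j)
        ≡⟨ cong₂ _*_ (length-cartesianProductWith _,_ es (upTo T)) (length-chains (lo + B) j) ⟩
      length es * length (upTo T) * ((length es * T) ^ j * length es)
        ≡⟨ cong (λ t → length es * t * ((length es * T) ^ j * length es)) (length-upTo T) ⟩
      length es * T * ((length es * T) ^ j * length es)
        ≡⟨ *-assoc (length es * T) _ _ ⟨
      (length es * T) ^ suc j * length es ∎
      where open ≡-Reasoning

    -- `chains` combines edges and joints blindly, including edges that do not meet and joints that
    -- are too close. These are the properties that the volume estimate requires and that every
    -- chain coming from a path has.
    record Admissible (cs : List (Subset N × ℕ)) : Set where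
      constructor admissible
      field
        spaced    : Spaced B 0 cs
        linked    : Linked cs
        sized     : All (HasSize n) cs
        length≡   : length cs ≡ suc ρ
        -- The widths telescope from 0 to `M`, except that each of the `ρ` joints belongs to two
        -- intervals and counts twice.
        widthSum≡ : widthSum 0 cs ≡ M + ρ

    admissible? : Decidable Admissible
    admissible? cs = map′
      (λ (a , b , c , d , e) → admissible a b c d e)
      (λ (admissible a b c d e) → a , b , c , d , e)
      (spaced? B 0 cs ×-dec linked? cs ×-dec All.all? (λ (e , _) → ∣ e ∣ ≟ n) cs ×-dec
       (length cs ≟ suc ρ) ×-dec (widthSum 0 cs ≟ M + ρ))

    module _ (w : Fin N → ℕ) (sized : All (λ e → ∣ e ∣ ≡ n) es) .{{_ : NonZero M}} (w<M : ∀ v → w v < M)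
             (long : ∀ {e v u} → e List.∈ es → Arc w es e v u → w v + B ≤ w u) where

      path-upper : ∀ j v → Path w es j v → w v + j * B < M
      path-upper zero    v _ = ≤-trans (≤-reflexive (cong suc (+-identityʳ (w v)))) (w<M v)
      path-upper (suc j) v (u , e∋ , p) = let e , e∈ , a = find e∋ in begin-strict
        w v + (B + j * B)  ≡⟨ +-assoc (w v) B _ ⟨
        w v + B + j * B    ≤⟨ +-monoˡ-≤ (j * B) (long e∈ a) ⟩
        w u + j * B        <⟨ path-upper j u p ⟩
        M                  ∎
        where open ≤-Reasoning

      Starts : Fin N → List (Subset N × ℕ) → Set
      Starts v []            = ⊤
      Starts v ((e , _) ∷ _) = v ∈ e

      meets : ∀ {u e} cs → u ∈ e → Starts u cs → Meets e cs
      meets []      _  _  = tt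
      meets (_ ∷ _) u∈ u∈′ = _ , x∈p∩q⁺ (u∈ , u∈′)

      -- `lo` is the total climb guaranteed so far and locates the windows; `x` is the true left end
      -- of the current interval, that is, the previous joint. The next joint is at least `lo + B`
      -- because its arc climbs by `B`, and below `lo + B + T` by `path-upper`. Starting at `x = 0`
      -- and ending at `pred M` leaves only the `ρ` joints to enumerate.
      path-chain : ∀ j {lo x} v → Path w es (suc j) v → lo ≤ w v → x ≤ w v → lo + suc j * B + T ≡ M →
                   ∃[ cs ] cs List.∈ chains lo j × Spaced B x cs × Linked cs × All (HasSize n) cs ×
                           length cs ≡ suc j × widthSum x cs + x ≡ M + j × Starts v cs ×
                           (∀ y → Fits x (column y cs) (w y))
      path-chain zero {lo} {x} v (u , e∋ , _) lo≤ x≤ lo+B+T≡M =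
        let e , e∈ , a@(v∈ , u∈ , mid) = find e∋ in
        (e , pred M) ∷ [] , ∈-map⁺ _ e∈ ,
        (≤-trans (+-monoˡ-≤ B x≤) (≤-trans (long e∈ a) (≤-trans (<⇒≤ (w<M u)) M≤)) , tt) ,
        (tt , tt) , All.lookup sized e∈ ∷ [] , refl ,
        (begin
          suc (pred M) ∸ x + 0 + x  ≡⟨ cong (_+ x) (+-identityʳ (suc (pred M) ∸ x)) ⟩
          suc (pred M) ∸ x + x      ≡⟨ cong (λ m → m ∸ x + x) (suc-pred M) ⟩
          M ∸ x + x                 ≡⟨ m∸n+n≡m (≤-trans x≤ (<⇒≤ (w<M v))) ⟩
          M                         ≡⟨ +-identityʳ M ⟨
          M + 0                     ∎) ,
        v∈ , λ y → (λ y∈ → ≤-trans x≤ (proj₁ (mid y (T⇒∈ y e y∈))) , s≤s⁻¹ (≤-trans (w<M y) M≤)) , tt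
        where
        open ≡-Reasoning
        M≤ : M ≤ suc (pred M)
        M≤ = ≤-reflexive (sym (suc-pred M))
      path-chain (suc j) {lo} {x} v (u , e∋ , p) lo≤ x≤ lo+B+T≡M =
        let e , e∈ , a@(v∈ , u∈ , mid) = find e∋
            lo+B≤wu = ≤-trans (+-monoˡ-≤ B lo≤) (long e∈ a)
            wv≤wu   = ≤-trans (m≤m+n (w v) B) (long e∈ a)
            t       = w u ∸ (lo + B)
            wu≡     = m+[n∸m]≡n lo+B≤wu
            cs , cs∈ , spaced , linked , sizes , len , sum , starts , fits =
              path-chain j {lo + B} {w u} u p lo+B≤wu ≤-refl
                (trans (solve 4 (λ l b s t → l :+ b :+ s :+ t
                     := l :+ (b :+ s) :+ t) refl lo B (suc j * B) T) lo+B+T≡M)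
        in
        (e , w u) ∷ cs ,
        subst (λ y → (e , y) ∷ cs List.∈ chains lo (suc j)) wu≡
          (∈-cartesianProductWith⁺ (λ (e , t) cs → (e , lo + B + t) ∷ cs)
            (∈-cartesianProduct⁺ e∈ (∈-upTo⁺ (+-cancelˡ-< (lo + B) t T (subst (_< lo + B + T) (sym wu≡) (wu< p))))) cs∈) ,
        (≤-trans (+-monoˡ-≤ B x≤) (m≤n⇒m≤1+n (long e∈ a)) , spaced) ,
        (meets cs u∈ starts , linked) , All.lookup sized e∈ ∷ sizes , cong suc len ,
        widthSum-step (≤-trans x≤ wv≤wu) sum ,
        v∈ , λ y → (λ y∈ → ≤-trans x≤ (proj₁ (mid y (T⇒∈ y e y∈))) , proj₂ (mid y (T⇒∈ y e y∈))) , fits y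
        where
        open +-*-Solver
        wu< : Path w es (suc j) u → w u < lo + B + T
        wu< p = +-cancelʳ-< (suc j * B) (w u) (lo + B + T) (≤-trans (path-upper (suc j) u p)
          (≤-reflexive (trans (sym lo+B+T≡M)
            (solve 4 (λ l b s t → l :+ (b :+ s) :+ t := l :+ b :+ t :+ s) refl lo B (suc j * B) T))))
        widthSum-step : ∀ {s} → x ≤ w u → s + w u ≡ M + j → suc (w u) ∸ x + s + x ≡ M + suc j
        widthSum-step {s} x≤wu eq = begin
          suc (w u) ∸ x + s + x
            ≡⟨ solve 3 (λ a s x → a :+ s :+ x := s :+ (a :+ x)) refl (suc (w u) ∸ x) s x ⟩
          s + (suc (w u) ∸ x + x)  ≡⟨ cong (s +_) (m∸n+n≡m (m≤n⇒m≤1+n x≤wu)) ⟩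
          s + suc (w u)            ≡⟨ +-suc s (w u) ⟩
          suc (s + w u)            ≡⟨ cong suc eq ⟩
          suc (M + j)              ≡⟨ +-suc M j ⟨
          M + suc j                ∎
          where open ≡-Reasoning

  -- The union bound over short edges and long paths

  module _ {N : ℕ} (es : List (Subset N)) (n ρ B T M : ℕ) .{{_ : NonZero M}} .{{_ : NonZero B}}
           (2≤B : 2 ≤ B) (M≤B² : M ≤ B * B) (sized : All (λ e → ∣ e ∣ ≡ n) es) where

    Box : Set
    Box = ℕ × List (Subset N × ℕ)

    InBox : Box → Fin N → ℕ → Set
    InBox (x , cs) v = Fits x (column v cs)

    inBox? : ∀ b v → Decidable (InBox b v)
    inBox? (x , cs) v = fits? x (column v cs)

    vol : Box → ℕ
    vol b = volume M (inBox? b)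

    -- A chain with a single edge, so that `box-volume` serves both families of boxes.
    shortBox : Subset N → ℕ → Box
    shortBox e x = x , (e , x + pred B) ∷ []

    shortBoxes chainBoxes : List Box
    shortBoxes = cartesianProductWith shortBox es (upTo M)
    chainBoxes = map (0 ,_) (filter (admissible? es n ρ B T M) (chains es n ρ B T M 0 ρ))

    suc[x+pred[B]]≡x+B : ∀ x → suc (x + pred B) ≡ x + B
    suc[x+pred[B]]≡x+B x = trans (sym (+-suc x (pred B))) (cong (x +_) (suc-pred B))

    short-volume : ∀ e x → ∣ e ∣ ≡ n → vol (shortBox e x) * M ^ n ≤ M ^ N * B ^ n
    short-volume e x ≡n = begin
      vol (shortBox e x) * M ^ n
        ≡⟨ *-identityʳ _ ⟨
      vol (shortBox e x) * M ^ n * 1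
        ≡⟨ cong (λ k → vol (shortBox e x) * M ^ k * 1) (*-identityˡ n) ⟨
      vol (shortBox e x) * M ^ (1 * n) * 1
        ≤⟨ box-volume M B 2≤B M≤B² x ((e , x + pred B) ∷ [])
             (≤-reflexive (sym (suc[x+pred[B]]≡x+B x)) , tt) (tt , tt) (≡n ∷ []) ⟩
      M ^ N * ((suc (x + pred B) ∸ x) * 1) ^ n * 1
        ≡⟨ trans (*-identityʳ _) (cong (λ a → M ^ N * a ^ n) (*-identityʳ _)) ⟩
      M ^ N * (suc (x + pred B) ∸ x) ^ n
        ≡⟨ cong (λ a → M ^ N * a ^ n) (trans (cong (_∸ x) (suc[x+pred[B]]≡x+B x)) (m+n∸m≡n x B)) ⟩
      M ^ N * B ^ n ∎
      where open ≤-Reasoning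

    short-total : 4 * (length es * M) * B ^ n ≤ M ^ n → 4 * sum (map vol shortBoxes) ≤ M ^ N
    short-total few = sum-≤ 4 (length es * M) (M ^ N) vol shortBoxes
      (≤-reflexive (trans (length-cartesianProductWith shortBox es (upTo M)) (cong (length es *_) (length-upTo M))))
      bound
      where
      open ≤-Reasoning
      open +-*-Solver
      bound : ∀ {b} → b List.∈ shortBoxes → 4 * (length es * M) * vol b ≤ M ^ N
      bound b∈ with ∈-cartesianProductWith⁻ shortBox es (upTo M) b∈
      ... | e , x , e∈ , _ , refl = *-cancelʳ-≤ _ _ (M ^ n) {{m^n≢0 M n}} (begin
        4 * (length es * M) * vol (shortBox e x) * M ^ n
          ≡⟨ *-assoc (4 * (length es * M)) _ _ ⟩
        4 * (length es * M) * (vol (shortBox e x) * M ^ n)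
          ≤⟨ *-monoʳ-≤ (4 * (length es * M)) (short-volume e x (All.lookup sized e∈)) ⟩
        4 * (length es * M) * (M ^ N * B ^ n)
          ≡⟨ solve 3 (λ c m b → c :* (m :* b) := m :* (c :* b)) refl (4 * (length es * M)) (M ^ N) (B ^ n) ⟩
        M ^ N * (4 * (length es * M) * B ^ n)
          ≤⟨ *-monoʳ-≤ (M ^ N) few ⟩
        M ^ N * M ^ n ∎)

    private
      r l R Q : ℕ
      r = suc ρ
      l = (length es * T) ^ ρ * length es
      R = r ^ (r * n)
      Q = M ^ (r * n)

    -- By `am-gm` the factor `(widths / M ^ r) ^ n` is at most `((M + ρ) / (r M)) ^ (r n)`. The
    -- shared endpoints, which turn `M` into `M + ρ`, cost at most the factor 2.
    chain-volume : Q * 2 ≥ (M + ρ) ^ (r * n) → ∀ {cs} → Admissible es n ρ B T M cs →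
                   vol (0 , cs) * (B * B) ^ ρ * R ≤ 2 * (M ^ N * M ^ ρ)
    chain-volume inflation {cs} (admissible spaced linked sized len total) = *-cancelʳ-≤ _ _ Q {{m^n≢0 M (r * n)}} (begin
      vol (0 , cs) * (B * B) ^ ρ * R * Q
        ≡⟨ solve 4 (λ v b R Q → v :* b :* R :* Q := v :* Q :* b :* R) refl (vol (0 , cs)) ((B * B) ^ ρ) R Q ⟩
      vol (0 , cs) * Q * (B * B) ^ ρ * R
        ≤⟨ *-monoˡ-≤ R (subst (λ k → vol (0 , cs) * M ^ (k * n) * (B * B) ^ (k ∸ 1) ≤ M ^ N * widths 0 cs ^ n * M ^ (k ∸ 1))
             len (box-volume M B 2≤B M≤B² 0 cs spaced linked sized)) ⟩
      M ^ N * widths 0 cs ^ n * M ^ ρ * R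
        ≡⟨ solve 4 (λ v b R Q → v :* b :* R :* Q
             := v :* R :* (Q :* b)) refl (M ^ N) (widths 0 cs ^ n) (M ^ ρ) R ⟩
      M ^ N * M ^ ρ * (R * widths 0 cs ^ n)
        ≤⟨ *-monoʳ-≤ (M ^ N * M ^ ρ) (begin
             R * widths 0 cs ^ n               ≡⟨ cong (_* widths 0 cs ^ n) (^-*-assoc r r n) ⟨
             (r ^ r) ^ n * widths 0 cs ^ n     ≡⟨ ^-* (r ^ r) (widths 0 cs) n ⟨
             (r ^ r * widths 0 cs) ^ n
               ≤⟨ ^-monoˡ-≤ n (subst (λ k → k ^ k * widths 0 cs ≤ widthSum 0 cs ^ k) len (am-gm 0 cs)) ⟩
             (widthSum 0 cs ^ r) ^ n           ≡⟨ cong (λ s → (s ^ r) ^ n) total ⟩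
             ((M + ρ) ^ r) ^ n                 ≡⟨ ^-*-assoc (M + ρ) r n ⟩
             (M + ρ) ^ (r * n)                 ≤⟨ inflation ⟩
             Q * 2                             ∎) ⟩
      M ^ N * M ^ ρ * (Q * 2)
        ≡⟨ solve 2 (λ m Q → m :* (Q :* con 2) := con 2 :* m :* Q) refl (M ^ N * M ^ ρ) Q ⟩
      2 * (M ^ N * M ^ ρ) * Q ∎)
      where
      open ≤-Reasoning
      open +-*-Solver

    -- The 8 is the 4 of the union bound times the 2 of `chain-volume`.
    chain-total : Q * 2 ≥ (M + ρ) ^ (r * n) → 8 * l * M ^ ρ ≤ (B * B) ^ ρ * R →
                  4 * sum (map vol chainBoxes) ≤ M ^ N
    chain-total inflation few = sum-≤ 4 l (M ^ N) vol chainBoxes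
      (≤-trans (≤-reflexive (length-map {B = Box} (0 ,_) (filter (admissible? es n ρ B T M) (chains es n ρ B T M 0 ρ))))
        (≤-trans (length-filter (admissible? es n ρ B T M) (chains es n ρ B T M 0 ρ))
        (≤-reflexive (length-chains es n ρ B T M 0 ρ))))
      bound
      where
      open ≤-Reasoning
      open +-*-Solver
      S : ℕ
      S = (B * B) ^ ρ
      S*R≢0 : NonZero (S * R)
      S*R≢0 = m*n≢0 S R {{m^n≢0 (B * B) ρ {{m*n≢0 B B}}}} {{m^n≢0 r (r * n)}}
      bound : ∀ {b} → b List.∈ chainBoxes → 4 * l * vol b ≤ M ^ N
      bound b∈ with ∈-map⁻ (0 ,_) b∈
      ... | cs , cs∈ , refl = *-cancelʳ-≤ _ _ (S * R) {{S*R≢0}} (begin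
        4 * l * vol (0 , cs) * (S * R)
          ≡⟨ solve 4 (λ l v S R → con 4 :* l :* v :* (S :* R)
               := con 4 :* l :* (v :* S :* R)) refl l (vol (0 , cs)) S R ⟩
        4 * l * (vol (0 , cs) * S * R)
          ≤⟨ *-monoʳ-≤ (4 * l) (chain-volume inflation (proj₂ (∈-filter⁻ (admissible? es n ρ B T M) {xs = chains es n ρ B T M 0 ρ} cs∈))) ⟩
        4 * l * (2 * (M ^ N * M ^ ρ))
          ≡⟨ solve 3 (λ l a b → con 4 :* l :* (con 2 :* (a :* b))
               := a :* (con 8 :* l :* b)) refl l (M ^ N) (M ^ ρ) ⟩
        M ^ N * (8 * l * M ^ ρ)           ≤⟨ *-monoʳ-≤ (M ^ N) few ⟩
        M ^ N * (S * R)                   ∎)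

    no-long-path : 4 * (length es * M) * B ^ n ≤ M ^ n → Q * 2 ≥ (M + ρ) ^ (r * n) →
                   8 * l * M ^ ρ ≤ (B * B) ^ ρ * R → r * B + T ≡ M →
                   Σ[ w ∈ (Fin N → ℕ) ] (∀ v → ¬ Path w es r v)
    no-long-path short inflation chain rB+T≡M =
      let w , w<M , avoids = avoid M inBox? (shortBoxes ++ chainBoxes) total
          long : ∀ {e v u} → e List.∈ es → Arc w es e v u → w v + B ≤ w u
          -- An arc that climbs by less than `B` would put its whole edge into the short box that
          -- starts at the weight of `v`.
          long {e} {v} {u} e∈ (_ , _ , mid) = ≮⇒≥ λ wu<wv+B → avoids
            (∈-++⁺ˡ (∈-cartesianProductWith⁺ shortBox e∈ (∈-upTo⁺ (w<M v))))
            (λ y → (λ y∈ → let wv≤wy , wy≤wu = mid y (T⇒∈ y e y∈) in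
                     wv≤wy , ≤-trans wy≤wu (s≤s⁻¹ (≤-trans wu<wv+B (≤-reflexive (sym (suc[x+pred[B]]≡x+B (w v))))))) ,
                   tt)
      in w , λ v path →
        let cs , cs∈ , spaced , linked , sizes , len , sum , _ , fits =
              path-chain es n ρ B T M w sized w<M long ρ {x = 0} v path z≤n z≤n rB+T≡M
        in avoids (∈-++⁺ʳ shortBoxes (∈-map⁺ (0 ,_) (∈-filter⁺ (admissible? es n ρ B T M) cs∈
             (admissible spaced linked sizes len (trans (sym (+-identityʳ _)) sum))))) fits
      where
      open ≤-Reasoning
      total : sum (map vol (shortBoxes ++ chainBoxes)) < M ^ N
      total = *-cancelˡ-< 4 _ _ (begin-strict
        4 * sum (map vol (shortBoxes ++ chainBoxes))
          ≡⟨ cong (λ xs → 4 * sum xs) (map-++ vol shortBoxes chainBoxes) ⟩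
        4 * sum (map vol shortBoxes ++ map vol chainBoxes)
          ≡⟨ cong (4 *_) (sum-++ (map vol shortBoxes) (map vol chainBoxes)) ⟩
        4 * (sum (map vol shortBoxes) + sum (map vol chainBoxes))
          ≡⟨ *-distribˡ-+ 4 (sum (map vol shortBoxes)) _ ⟩
        4 * sum (map vol shortBoxes) + 4 * sum (map vol chainBoxes)
          ≤⟨ +-mono-≤ (short-total short) (chain-total inflation chain) ⟩
        M ^ N + M ^ N
          ≡⟨ cong (M ^ N +_) (+-identityʳ (M ^ N)) ⟨
        2 * M ^ N
          <⟨ *-monoˡ-< (M ^ N) {{m^n≢0 M N}} {2} {4} (s≤s (s≤s (s≤s z≤n))) ⟩
        4 * M ^ N ∎)

  nonempty : ∀ {N n} .{{_ : NonZero n}} (e : Subset N) → ∣ e ∣ ≡ n → Nonempty e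
  nonempty {N} {suc n} e ≡n with nonempty? e
  ... | yes ne = ne
  ... | no ¬ne = contradiction (trans (sym ≡n) (trans (cong ∣_∣ (Empty-unique ¬ne)) (∣⊥∣≡0 N))) λ ()

  -- Choice of the scales

  bernoulli : ∀ p m → p ^ suc m + suc m * p ^ m ≤ suc p ^ suc m
  bernoulli p zero    = ≤-reflexive (solve 1 (λ p → p :* con 1 :+ con 1 := (con 1 :+ p) :* con 1) refl p)
    where open +-*-Solver
  bernoulli p (suc m) = begin
    p * (p * P) + suc (suc m) * (p * P)
      ≤⟨ m≤m+n _ (suc m * P) ⟩
    p * (p * P) + suc (suc m) * (p * P) + suc m * P
      ≡⟨ solve 3 (λ p m P → p :* (p :* P) :+ (con 2 :+ m) :* (p :* P) :+ (con 1 :+ m) :* P :=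
           (con 1 :+ p) :* (p :* P :+ (con 1 :+ m) :* P)) refl p m P ⟩
    suc p * (p * P + suc m * P)
      ≤⟨ *-monoʳ-≤ (suc p) (bernoulli p m) ⟩
    suc p * suc p ^ suc m ∎
    where
    open ≤-Reasoning
    open +-*-Solver
    P = p ^ m

  -- `(1 + 1 / p) ^ (p + 1)` is at least 2 by `bernoulli`; this happens `s` times among the `n`
  -- factors.
  doubling : ∀ p s n → suc p * s ≤ n → 2 ^ s * p ^ n ≤ suc p ^ n
  doubling p s n qs≤n = begin
    2 ^ s * p ^ n                    ≡⟨ cong (2 ^ s *_) (split p) ⟩
    2 ^ s * ((p ^ q) ^ s * p ^ e)    ≡⟨ *-assoc (2 ^ s) _ _ ⟨
    2 ^ s * (p ^ q) ^ s * p ^ e      ≡⟨ cong (_* p ^ e) (^-* 2 (p ^ q) s) ⟨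
    (2 * p ^ q) ^ s * p ^ e          ≤⟨ *-mono-≤ (^-monoˡ-≤ s twice) (^-monoˡ-≤ e (n≤1+n p)) ⟩
    (q ^ q) ^ s * q ^ e              ≡⟨ split q ⟨
    q ^ n                            ∎
    where
    open ≤-Reasoning
    q = suc p
    e = n ∸ q * s
    split : ∀ b → b ^ n ≡ (b ^ q) ^ s * b ^ e
    split b = trans (cong (b ^_) (sym (m+[n∸m]≡n qs≤n)))
             (trans (^-distribˡ-+-* b (q * s) e) (cong (_* b ^ e) (sym (^-*-assoc b q s))))
    twice : 2 * p ^ q ≤ q ^ q
    twice = ≤-trans (≤-trans (≤-reflexive (cong (p ^ q +_) (+-identityʳ (p ^ q))))
                             (+-monoʳ-≤ (p ^ q) (*-monoˡ-≤ (p ^ p) (n≤1+n p))))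
                    (bernoulli p p)

  module _ (a d : ℕ) .{{_ : NonZero a}} where

    private A′ = a + d

    -- The mean value bound on `(a + d) ^ j - a ^ j`, multiplied by `a + d` to avoid the exponent
    -- `j - 1`.
    power-increment : ∀ j → A′ ^ suc j ≤ A′ * a ^ j + j * d * A′ ^ j
    power-increment zero    = m≤m+n _ _
    power-increment (suc j) = begin
      A′ * (A′ ^ suc j)                           ≤⟨ *-monoʳ-≤ A′ (power-increment j) ⟩
      A′ * (A′ * a ^ j + j * d * A′ ^ j)
        ≡⟨ solve 5 (λ a d p q j → (a :+ d) :* ((a :+ d) :* p :+ j :* d :* q) :=
             (a :+ d) :* (a :* p) :+ (d :* ((a :+ d) :* p) :+ j :* d :* ((a :+ d) :* q))) refl a d (a ^ j) (A′ ^ j) j ⟩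
      A′ * a ^ suc j + (d * (A′ * a ^ j) + j * d * A′ ^ suc j)
        ≤⟨ +-monoʳ-≤ (A′ * a ^ suc j) (+-monoˡ-≤ (j * d * A′ ^ suc j) (*-monoʳ-≤ d (*-monoʳ-≤ A′ (^-monoˡ-≤ j (m≤m+n a d))))) ⟩
      A′ * a ^ suc j + (d * A′ ^ suc j + j * d * A′ ^ suc j)
        ≡⟨ cong (A′ * a ^ suc j +_) (*-distribʳ-+ (A′ ^ suc j) d (j * d)) ⟨
      A′ * a ^ suc j + suc j * d * A′ ^ suc j ∎
      where
      open ≤-Reasoning
      open +-*-Solver

    small-increment : ∀ j → 2 * (j * d) ≤ A′ → A′ ^ j ≤ a ^ j * 2
    small-increment j 2jd≤A = *-cancelˡ-≤ A′ {{m+n≢0 a d}} (+-cancelʳ-≤ (A′ * A′ ^ j) _ _ (begin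
      A′ * A′ ^ j + A′ * A′ ^ j             ≡⟨ cong (A′ * A′ ^ j +_) (+-identityʳ _) ⟨
      2 * A′ ^ suc j                        ≤⟨ *-monoʳ-≤ 2 (power-increment j) ⟩
      2 * (A′ * a ^ j + j * d * A′ ^ j)
        ≡⟨ solve 4 (λ A p x q → con 2 :* (A :* p :+ x :* q)
             := A :* (p :* con 2) :+ con 2 :* x :* q) refl A′ (a ^ j) (j * d) (A′ ^ j) ⟩
      A′ * (a ^ j * 2) + 2 * (j * d) * A′ ^ j ≤⟨ +-monoʳ-≤ (A′ * (a ^ j * 2)) (*-monoˡ-≤ (A′ ^ j) 2jd≤A) ⟩
      A′ * (a ^ j * 2) + A′ * A′ ^ j        ∎))
      where
      open ≤-Reasoning
      open +-*-Solver
      m+n≢0 : ∀ m n .{{_ : NonZero m}} → NonZero (m + n)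
      m+n≢0 (suc _) _ = nonZero

  8+8L≤2^L : ∀ {L} → 6 ≤ L → 8 + 8 * L ≤ 2 ^ L
  8+8L≤2^L {L} 6≤L = subst (λ L → 8 + 8 * L ≤ 2 ^ L) (m+[n∸m]≡n 6≤L) (go (L ∸ 6))
    where
    open ≤-Reasoning
    open +-*-Solver
    go : ∀ d → 8 + 8 * (6 + d) ≤ 2 ^ (6 + d)
    go zero    = m≤m+n 56 8
    go (suc d) = begin
      8 + 8 * (7 + d)                    ≤⟨ m≤m+n _ (48 + 8 * d) ⟩
      8 + 8 * (7 + d) + (48 + 8 * d)
        ≡⟨ solve 1 (λ d → con 8 :+ con 8 :* (con 7 :+ d) :+ (con 48 :+ con 8 :* d)
             := con 2 :* (con 8 :+ con 8 :* (con 6 :+ d))) refl d ⟩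
      2 * (8 + 8 * (6 + d))              ≤⟨ *-monoʳ-≤ 2 (go d) ⟩
      2 * 2 ^ (6 + d)                    ∎

  -- Here T / M = 1 / (p + 1), where p + 1 = ⌊ n / s ⌋ for s = 4 (L + 1) and L = ⌊log₂ n⌋.
  module Scales (r ρ n L k p : ℕ) (r≡ : r ≡ suc ρ)
                .{{r≢0 : NonZero r}} .{{_ : NonZero n}} .{{_ : NonZero L}} .{{_ : NonZero p}}
                (n<2^L : n < 2 ^ suc L)
                (q*s≤n : suc p * (suc L * 4) ≤ n) (n<[1+q]*s : n < suc L * 4 + suc p * (suc L * 4))
                (large : 64 * (r * r) ≤ n)
                (few : 8 * k ^ r * (64 * (r * r) * L) ^ ρ ≤ n ^ ρ * r ^ (r * n)) where

    private
      q s m : ℕ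
      q = suc p
      s = suc L * 4
      m = 2 * (r * n)

    -- All three are multiples of the unit `m`, so their ratios depend only on `r` and `p`. The size
    -- `2 r n` of the unit makes `M₀` large enough for `inflation` and `B₀` large enough for `M≤B²`.
    B₀ T₀ M₀ : ℕ
    B₀ = m * p
    T₀ = r * m
    M₀ = r * (m * q)

    B₀≢0 : NonZero B₀
    B₀≢0 = m*n≢0 m p {{m*n≢0 2 (r * n) {{_}} {{m*n≢0 r n}}}}

    M₀≢0 : NonZero M₀
    M₀≢0 = m*n≢0 r (m * q) {{r≢0}} {{m*n≢0 m q {{m*n≢0 2 (r * n) {{_}} {{m*n≢0 r n}}}}}}

    open ≤-Reasoning
    open +-*-Solver

    rB+T≡M : r * B₀ + T₀ ≡ M₀
    rB+T≡M = solve 3 (λ r m p → r :* (m :* p) :+ r :* m := r :* (m :* (con 1 :+ p))) refl r m p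

    q≤2p : q ≤ 2 * p
    q≤2p = ≤-trans (+-monoˡ-≤ p (>-nonZero⁻¹ p)) (≤-reflexive (cong (p +_) (sym (+-identityʳ p))))

    2≤B : 2 ≤ B₀
    2≤B = begin
      2            ≤⟨ m≤m*n 2 (r * n) {{m*n≢0 r n}} ⟩
      m            ≤⟨ m≤m*n m p ⟩
      m * p        ∎

    M≤B² : M₀ ≤ B₀ * B₀
    M≤B² = begin
      r * (m * q)        ≤⟨ *-monoʳ-≤ r (*-monoʳ-≤ m q≤2p) ⟩
      r * (m * (2 * p))  ≡⟨ solve 3 (λ r m p → r :* (m :* (con 2 :* p)) := m :* p :* (con 2 :* r)) refl r m p ⟩
      B₀ * (2 * r)       ≤⟨ *-monoʳ-≤ B₀ (≤-trans (*-monoʳ-≤ 2 (m≤m*n r n)) (m≤m*n m p)) ⟩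
      B₀ * B₀            ∎

    -- The bound on short edges is linear in `k`, while `few` controls `k ^ r`; comparing `r`-th
    -- powers gives this crude estimate, whose factor `n` is harmless in `few-short`.
    k≤nr^n : k ≤ n * r ^ n
    k≤nr^n = ≮⇒≥ λ nr^n<k → <⇒≱ (^-monoˡ-< r nr^n<k) (begin
      k ^ r                                 ≤⟨ m≤n*m (k ^ r) 8 ⟩
      8 * k ^ r
        ≤⟨ m≤m*n (8 * k ^ r) _ {{m^n≢0 (64 * (r * r) * L) ρ {{m*n≢0 _ L {{m*n≢0 64 _ {{_}} {{m*n≢0 r r}}}}}}}} ⟩
      8 * k ^ r * (64 * (r * r) * L) ^ ρ    ≤⟨ few ⟩
      n ^ ρ * r ^ (r * n)
        ≤⟨ *-monoˡ-≤ (r ^ (r * n)) (^-monoʳ-≤ n (≤-trans (n≤1+n ρ) (≤-reflexive (sym r≡)))) ⟩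
      n ^ r * r ^ (r * n)                   ≡⟨ cong (λ e → n ^ r * r ^ e) (*-comm r n) ⟩
      n ^ r * r ^ (n * r)                   ≡⟨ cong (n ^ r *_) (^-*-assoc r n r) ⟨
      n ^ r * (r ^ n) ^ r                   ≡⟨ ^-* n (r ^ n) r ⟨
      (n * r ^ n) ^ r                       ∎)

    -- Without the common factor `r ^ n * m ^ n` this reduces to `8 r² n² q p ^ n ≤ q ^ n`. The
    -- coefficient is at most `n ^ 4 ≤ 2 ^ (4 (L + 1))`, and `doubling` gains `2 ^ s`: hence the
    -- choice `s = 4 (L + 1)`.
    few-short : 4 * (k * M₀) * B₀ ^ n ≤ M₀ ^ n
    few-short = begin
      4 * (k * M₀) * B₀ ^ n
        ≤⟨ *-monoˡ-≤ (B₀ ^ n) (*-monoʳ-≤ 4 (*-monoˡ-≤ M₀ k≤nr^n)) ⟩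
      4 * (n * r ^ n * M₀) * B₀ ^ n
        ≡⟨ cong (4 * (n * r ^ n * M₀) *_) (^-* m p n) ⟩
      4 * (n * r ^ n * M₀) * (m ^ n * p ^ n)
        ≡⟨ solve 7 (λ n R M P r q Y → con 4 :* (n :* R :* (r :* (con 2 :* (r :* n) :* q))) :* (M :* P) :=
             R :* M :* (con 8 :* (r :* r) :* n :* n :* q :* P)) refl n (r ^ n) (m ^ n) (p ^ n) r q 0 ⟩
      r ^ n * m ^ n * (8 * (r * r) * n * n * q * p ^ n)
        ≤⟨ *-monoʳ-≤ (r ^ n * m ^ n) (≤-trans (*-monoˡ-≤ (p ^ n) quartic) (doubling p s n q*s≤n)) ⟩
      r ^ n * m ^ n * q ^ n
        ≡⟨ *-assoc (r ^ n) _ _ ⟩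
      r ^ n * (m ^ n * q ^ n)
        ≡⟨ cong (r ^ n *_) (^-* m q n) ⟨
      r ^ n * (m * q) ^ n
        ≡⟨ ^-* r (m * q) n ⟨
      M₀ ^ n ∎
      where
      quartic : 8 * (r * r) * n * n * q ≤ 2 ^ s
      quartic = begin
        8 * (r * r) * n * n * q
          ≤⟨ *-mono-≤ (*-monoˡ-≤ n (*-monoˡ-≤ n (≤-trans (*-monoˡ-≤ (r * r) (m≤m+n 8 56)) large))) (≤-trans (m≤m*n q s) q*s≤n) ⟩
        n * n * n * n
          ≡⟨ solve 1 (λ n → n :* n :* n :* n := n :* (n :* (n :* (n :* con 1)))) refl n ⟩
        n ^ 4                ≤⟨ ^-monoˡ-≤ 4 (<⇒≤ n<2^L) ⟩
        (2 ^ suc L) ^ 4      ≡⟨ ^-*-assoc 2 (suc L) 4 ⟩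
        2 ^ s                ∎

    inflation : M₀ ^ (r * n) * 2 ≥ (M₀ + ρ) ^ (r * n)
    inflation = small-increment M₀ ρ {{M₀≢0}} (r * n) (begin
      2 * (r * n * ρ)    ≤⟨ *-monoʳ-≤ 2 (*-monoʳ-≤ (r * n) (≤-trans (n≤1+n ρ) (≤-reflexive (sym r≡)))) ⟩
      2 * (r * n * r)    ≡⟨ solve 2 (λ r n → con 2 :* (r :* n :* r) := r :* (con 2 :* (r :* n))) refl r n ⟩
      r * m              ≤⟨ *-monoʳ-≤ r (m≤m*n m q) ⟩
      M₀                 ≤⟨ m≤m+n M₀ ρ ⟩
      M₀ + ρ             ∎)

    n≤16Lq : n ≤ 16 * L * q
    n≤16Lq = begin
      n                                      ≤⟨ <⇒≤ n<[1+q]*s ⟩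
      s + q * s                              ≤⟨ +-monoˡ-≤ (q * s) (m≤n*m s q) ⟩
      q * s + q * s
        ≡⟨ solve 2 (λ q L → q :* ((con 1 :+ L) :* con 4) :+ q :* ((con 1 :+ L) :* con 4)
             := con 8 :* (con 1 :+ L) :* q) refl q L ⟩
      8 * suc L * q                          ≤⟨ *-monoˡ-≤ q (*-monoʳ-≤ 8 (+-monoˡ-≤ L (>-nonZero⁻¹ L))) ⟩
      8 * (L + L) * q
        ≡⟨ solve 2 (λ q L → con 8 :* (L :+ L) :* q := con 16 :* L :* q) refl q L ⟩
      16 * L * q                             ∎

    -- The unit cancels in `T₀ M₀ / B₀² = r² q / p²`. By `q≤2p` this is at most `4 r² / q`, and by
    -- `n≤16Lq` at most `64 r² L / n`, the base occurring in `few`.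
    few-chains : 8 * ((k * T₀) ^ ρ * k) * M₀ ^ ρ ≤ (B₀ * B₀) ^ ρ * r ^ (r * n)
    few-chains = begin
      8 * ((k * T₀) ^ ρ * k) * M₀ ^ ρ
        ≡⟨ cong (λ x → 8 * (x * k) * M₀ ^ ρ) (^-* k T₀ ρ) ⟩
      8 * (k ^ ρ * T₀ ^ ρ * k) * M₀ ^ ρ
        ≡⟨ solve 4 (λ K T k M → con 8 :* (K :* T :* k) :* M
             := con 8 :* (k :* K) :* (T :* M)) refl (k ^ ρ) (T₀ ^ ρ) k (M₀ ^ ρ) ⟩
      8 * k ^ suc ρ * (T₀ ^ ρ * M₀ ^ ρ)
        ≡⟨ cong₂ (λ j x → 8 * k ^ j * x) r≡ (^-* T₀ M₀ ρ) ⟨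
      8 * k ^ r * (T₀ * M₀) ^ ρ
        ≡⟨ cong (λ x → 8 * k ^ r * x ^ ρ) (solve 3 (λ r m q → r :* m :* (r :* (m :* q))
             := m :* m :* (r :* r :* q)) refl r m q) ⟩
      8 * k ^ r * (m * m * (r * r * q)) ^ ρ
        ≡⟨ cong (8 * k ^ r *_) (^-* (m * m) _ ρ) ⟩
      8 * k ^ r * ((m * m) ^ ρ * (r * r * q) ^ ρ)
        ≡⟨ solve 3 (λ a b c → a :* (b :* c) := b :* (a :* c)) refl (8 * k ^ r) ((m * m) ^ ρ) _ ⟩
      (m * m) ^ ρ * (8 * k ^ r * (r * r * q) ^ ρ)
        ≤⟨ *-monoʳ-≤ ((m * m) ^ ρ) reduced ⟩
      (m * m) ^ ρ * ((p * p) ^ ρ * R)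
        ≡⟨ *-assoc ((m * m) ^ ρ) _ _ ⟨
      (m * m) ^ ρ * (p * p) ^ ρ * R
        ≡⟨ cong (_* R) (^-* (m * m) (p * p) ρ) ⟨
      (m * m * (p * p)) ^ ρ * R
        ≡⟨ cong (λ x → x ^ ρ * R) (*-interchange m m p p) ⟩
      (B₀ * B₀) ^ ρ * R ∎
      where
      R : ℕ
      R = r ^ (r * n)
      reduced : 8 * k ^ r * (r * r * q) ^ ρ ≤ (p * p) ^ ρ * R
      reduced = *-cancelʳ-≤ _ _ ((64 * L) ^ ρ) {{m^n≢0 (64 * L) ρ {{m*n≢0 64 L}}}} (begin
        8 * k ^ r * (r * r * q) ^ ρ * (64 * L) ^ ρ
          ≡⟨ *-assoc (8 * k ^ r) _ _ ⟩
        8 * k ^ r * ((r * r * q) ^ ρ * (64 * L) ^ ρ)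
          ≡⟨ cong (8 * k ^ r *_) (^-* (r * r * q) (64 * L) ρ) ⟨
        8 * k ^ r * (r * r * q * (64 * L)) ^ ρ
          ≡⟨ cong (λ x → 8 * k ^ r * x ^ ρ) (solve 3 (λ r q L → r :* r :* q :* (con 64 :* L)
               := con 64 :* (r :* r) :* L :* q) refl r q L) ⟩
        8 * k ^ r * (64 * (r * r) * L * q) ^ ρ
          ≡⟨ cong (8 * k ^ r *_) (^-* (64 * (r * r) * L) q ρ) ⟩
        8 * k ^ r * ((64 * (r * r) * L) ^ ρ * q ^ ρ)
          ≡⟨ *-assoc (8 * k ^ r) _ _ ⟨
        8 * k ^ r * (64 * (r * r) * L) ^ ρ * q ^ ρ
          ≤⟨ *-monoˡ-≤ (q ^ ρ) few ⟩
        n ^ ρ * R * q ^ ρ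
          ≤⟨ *-monoˡ-≤ (q ^ ρ) (*-monoˡ-≤ R (^-monoˡ-≤ ρ n≤16Lq)) ⟩
        (16 * L * q) ^ ρ * R * q ^ ρ
          ≡⟨ solve 3 (λ a b c → a :* b :* c := a :* c :* b) refl ((16 * L * q) ^ ρ) R (q ^ ρ) ⟩
        (16 * L * q) ^ ρ * q ^ ρ * R
          ≡⟨ cong (_* R) (^-* (16 * L * q) q ρ) ⟨
        (16 * L * q * q) ^ ρ * R
          ≤⟨ *-monoˡ-≤ R (^-monoˡ-≤ ρ (begin
               16 * L * q * q                ≡⟨ *-assoc (16 * L) q q ⟩
               16 * L * (q * q)              ≤⟨ *-monoʳ-≤ (16 * L) (*-mono-≤ q≤2p q≤2p) ⟩
               16 * L * (2 * p * (2 * p))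
                 ≡⟨ solve 2 (λ L p → con 16 :* L :* (con 2 :* p :* (con 2 :* p))
                      := p :* p :* (con 64 :* L)) refl L p ⟩
               p * p * (64 * L)              ∎)) ⟩
        (p * p * (64 * L)) ^ ρ * R
          ≡⟨ cong (_* R) (^-* (p * p) (64 * L) ρ) ⟩
        (p * p) ^ ρ * (64 * L) ^ ρ * R
          ≡⟨ solve 3 (λ a b c → a :* b :* c := a :* c :* b) refl ((p * p) ^ ρ) ((64 * L) ^ ρ) R ⟩
        (p * p) ^ ρ * R * (64 * L) ^ ρ ∎)

  few-edges⇒colourable : (H : Hypergraph) → ∀ ρ n L → Uniform H n →
    2 ^ L ≤ n → n < 2 ^ suc L → 64 * (suc ρ * suc ρ) ≤ n →
    8 * size H ^ suc ρ * (64 * (suc ρ * suc ρ) * L) ^ ρ ≤ n ^ ρ * suc ρ ^ (suc ρ * n) → Colorable H (suc ρ)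
  few-edges⇒colourable H ρ n L uniform 2^L≤n n<2^L large few = go (n / s) 2≤n/s (m/n*n≤m n s) n<s+n/s*s
    where
    s : ℕ
    s = suc L * 4
    n<s+n/s*s : n < s + n / s * s
    n<s+n/s*s = ≤-trans (≤-reflexive (cong suc (m≡m%n+[m/n]*n n s))) (+-monoˡ-≤ (n / s * s) (m%n<n n s))
    64≤n : 64 ≤ n
    64≤n = ≤-trans (m≤m*n 64 (suc ρ * suc ρ)) large
    6≤L : 6 ≤ L
    6≤L = ≮⇒≥ λ L<6 → <⇒≱ n<2^L (≤-trans (^-monoʳ-≤ 2 L<6) 64≤n)
    2s≤n : 2 * s ≤ n
    2s≤n = ≤-trans (≤-reflexive (solve 1 (λ L → con 2 :* ((con 1 :+ L) :* con 4)
         := con 8 :+ con 8 :* L) refl L))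
                   (≤-trans (8+8L≤2^L 6≤L) 2^L≤n)
      where open +-*-Solver
    -- The quotient is `p + 1`, and `p` has to be positive for `q≤2p`.
    2≤n/s : 2 ≤ n / s
    2≤n/s = ≤-trans (≤-reflexive (sym (m*n/n≡m 2 s))) (/-monoˡ-≤ s 2s≤n)
    n≢0 : NonZero n
    n≢0 = >-nonZero (≤-trans (s≤s z≤n) 64≤n)
    go : ∀ q → 2 ≤ q → q * s ≤ n → n < s + q * s → Colorable H (suc ρ)
    go (suc p) (s≤s p>0) qs≤n n<[1+q]s =
      let w , ¬path = no-long-path (edges H) n ρ B₀ T₀ M₀ {{M₀≢0}} {{B₀≢0}} 2≤B M≤B² uniform few-short inflation few-chains rB+T≡M
      in colourable H w (All.map (λ {e} → nonempty {{n≢0}} e) uniform) ρ ¬path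
      where
      open Scales (suc ρ) ρ n L (size H) p refl
        {{_}} {{n≢0}} {{>-nonZero (≤-trans (s≤s z≤n) 6≤L)}} {{>-nonZero p>0}} n<2^L qs≤n n<[1+q]s large few

  -- The factor 8 is absorbed by one of the r factors c = 2 a.
  constant-absorbed : ∀ r ρ n k L a c → r ≡ suc ρ → c ≡ 2 * a → 8 ≤ c →
                      (k * c) ^ r * L ^ ρ ≤ (2 * n) ^ ρ * (r ^ n) ^ r →
                      8 * k ^ r * (a * L) ^ ρ ≤ n ^ ρ * r ^ (r * n)
  constant-absorbed r ρ n k L a c r≡ c≡ 8≤c h = *-cancelˡ-≤ (2 ^ ρ) {{m^n≢0 2 ρ}} (begin
    2 ^ ρ * (8 * k ^ r * (a * L) ^ ρ)
      ≡⟨ cong (λ x → 2 ^ ρ * (8 * k ^ r * x)) (^-* a L ρ) ⟩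
    2 ^ ρ * (8 * k ^ r * (a ^ ρ * L ^ ρ))
      ≡⟨ solve 4 (λ t K C l → t :* (con 8 :* K :* (C :* l))
           := K :* (con 8 :* (t :* C)) :* l) refl (2 ^ ρ) (k ^ r) (a ^ ρ) (L ^ ρ) ⟩
    k ^ r * (8 * (2 ^ ρ * a ^ ρ)) * L ^ ρ
      ≡⟨ cong (λ x → k ^ r * (8 * x) * L ^ ρ) (trans (sym (^-* 2 a ρ)) (cong (_^ ρ) (sym c≡))) ⟩
    k ^ r * (8 * c ^ ρ) * L ^ ρ
      ≤⟨ *-monoˡ-≤ (L ^ ρ) (*-monoʳ-≤ (k ^ r) (≤-trans (*-monoˡ-≤ (c ^ ρ) 8≤c) (≤-reflexive (cong (c ^_) (sym r≡))))) ⟩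
    k ^ r * c ^ r * L ^ ρ
      ≡⟨ cong (_* L ^ ρ) (^-* k c r) ⟨
    (k * c) ^ r * L ^ ρ
      ≤⟨ h ⟩
    (2 * n) ^ ρ * (r ^ n) ^ r
      ≡⟨ cong₂ _*_ (^-* 2 n ρ) (trans (^-*-assoc r n r) (cong (r ^_) (*-comm n r))) ⟩
    2 ^ ρ * n ^ ρ * r ^ (r * n)
      ≡⟨ *-assoc (2 ^ ρ) _ _ ⟩
    2 ^ ρ * (n ^ ρ * r ^ (r * n)) ∎)
    where
    open ≤-Reasoning
    open +-*-Solver

open import Defs
open import Data.Nat.Base as ℕ using (ℕ; NonTrivial)
open import Data.Product.Base using (Σ-syntax; ∃-syntax)

open import Data.Nat.Base using (suc; NonZero)
import Data.Nat.Properties as ℕ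
open import Data.Product.Base using (_,_)
open import Data.Rational.Base using (_<_)
open import Relation.Binary.PropositionalEquality using (_≡_; refl; sym; subst)

module Bounds where

  open Colouring using (few-edges⇒colourable; constant-absorbed)
  open Hypergraph using (size; Uniform; Colorable)
  open RationalLemmas renaming (_^_ to infixr 8 _ℚ^_)
  open import Data.Integer.Base as ℤ using (+_)
  import Data.Integer.Properties as ℤ
  open import Data.Nat.Base using (zero; suc; NonZero)
  import Data.Nat.Properties as ℕ
  open import Data.Product.Base using (_×_; _,_)
  open import Data.Rational.Base as ℚ using (ℚ; 0ℚ; 1ℚ; ½; _≤_; _<_; _+_; *≤*) renaming (_*_ to _·_)
  import Data.Rational.Properties as ℚ
  open import Data.Rational.Solver using (module +-*-Solver)
  open import Relation.Binary.PropositionalEquality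
  open import Relation.Nullary using (¬_; yes; no; contradiction)

  -- Rational bounds for the real expression

  infix 4 _≼_ _≽_

  -- Upper bounds are tested on the lower cut and lower bounds on the upper cut. A reciprocal
  -- exchanges the cuts, which is why `ln n` is bounded through its upper cut.
  _≼_ _≽_ : ℝ⁺ → ℚ → Set
  x ≼ u = ∀ q → ℝ⁺.lower x q → q ≤ u
  x ≽ l = ∀ q → ℝ⁺.upper x q → l ≤ q

  fromℕ⁺-≼ : ∀ n .{{_ : NonZero n}} → fromℕ⁺ n ≼ nat n
  fromℕ⁺-≼ n _ (_ , refl , q<n) = ℚ.≤-trans (ℚ.<⇒≤ q<n) (ℚ.≤-reflexive (sym (nat≡ n)))

  fromℕ⁺-≽ : ∀ n .{{_ : NonZero n}} → fromℕ⁺ n ≽ nat n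
  fromℕ⁺-≽ n _ (_ , refl , n<q) = ℚ.≤-trans (ℚ.≤-reflexive (nat≡ n)) (ℚ.<⇒≤ n<q)

  *-≼ : ∀ x y {u v} → x ≼ u → y ≼ v → x * y ≼ u · v
  *-≼ x y {u} {v} x≼u y≼v _ (_ , (a , b , (a>0 , la) , (b>0 , lb) , refl) , q<ab) = ℚ.≤-trans (ℚ.<⇒≤ q<ab)
    (ℚ.≤-trans (*-monoˡ-≤ (ℚ.<⇒≤ b>0) (x≼u _ la)) (*-monoʳ-≤ (ℚ.<⇒≤ (ℚ.<-≤-trans a>0 (x≼u _ la))) (y≼v _ lb)))

  ^-≼ : ∀ x {u} n → x ≼ u → x ^ n ≼ u ℚ^ n
  ^-≼ x zero    x≼u = fromℕ⁺-≼ 1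
  ^-≼ x (suc n) x≼u = *-≼ x (x ^ n) x≼u (^-≼ x n x≼u)

  ⁻¹-≼ : ∀ x {l i} → 0ℚ < i → i · l ≡ 1ℚ → x ≽ l → x ⁻¹ ≼ i
  ⁻¹-≼ x {l} {i} i>0 il≡1 x≽l q (c , (c>0 , b , ub , cb≡1) , q<c) = begin
    q            ≤⟨ ℚ.<⇒≤ q<c ⟩
    c            ≡⟨ inverse-cancel l i c il≡1 ⟨
    l · (i · c)  ≡⟨ solve 3 (λ l i c → l :* (i :* c) := i :* (c :* l)) refl l i c ⟩
    i · (c · l)  ≤⟨ *-monoʳ-≤ (ℚ.<⇒≤ i>0) (*-monoʳ-≤ (ℚ.<⇒≤ c>0) (x≽l _ ub)) ⟩
    i · (c · b)  ≡⟨ cong (i ·_) cb≡1 ⟩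
    i · 1ℚ       ≡⟨ ℚ.*-identityʳ i ⟩
    i            ∎
    where
    open ℚ.≤-Reasoning
    open +-*-Solver

  harmonic-mono : ∀ a {m n} → m ℕ.≤ n → harmonic a m ≤ harmonic a n
  harmonic-mono a {m} {n} m≤n = begin
    harmonic a m                                     ≡⟨ ℚ.+-identityʳ _ ⟨
    harmonic a m + 0ℚ
      ≤⟨ ℚ.+-monoʳ-≤ (harmonic a m) (harmonic-≥0 (m ℕ.+ a) (n ℕ.∸ m)) ⟩
    harmonic a m + harmonic (m ℕ.+ a) (n ℕ.∸ m)      ≡⟨ harmonic-+ a m (n ℕ.∸ m) ⟨
    harmonic a (m ℕ.+ (n ℕ.∸ m))                     ≡⟨ cong (harmonic a) (ℕ.m+[n∸m]≡n m≤n) ⟩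
    harmonic a n                                     ∎
    where open ℚ.≤-Reasoning

  ½≤harmonic : ∀ a .{{_ : NonZero a}} → ½ ≤ harmonic a a
  ½≤harmonic (suc a) = ℚ.≤-trans (ℚ.≤-reflexive (recip-split 1 a))
    (harmonic-≥ (suc a) (suc a) (ℕ.≤-reflexive (cong (λ b → suc a ℕ.+ b) (sym (ℕ.*-identityˡ (suc a))))))

  -- Oresme's grouping of `1/2 + ⋯ + 1/2^j`: the terms after `1/P` up to `1/(2P)` are `P` in number
  -- and each at least `1/(2P)`.
  harmonic-2^ : ∀ j → nat j · ½ ≤ harmonic 1 (2 ℕ.^ j ℕ.∸ 1)
  harmonic-2^ zero    = ℚ.≤-reflexive (ℚ.*-zeroˡ ½)
  harmonic-2^ (suc j) = begin
    nat (suc j) · ½                         ≡⟨ cong (_· ½) (nat-+ 1 j) ⟩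
    (1ℚ + nat j) · ½
      ≡⟨ solve 1 (λ x → (con 1ℚ :+ x) :* con ½ := x :* con ½ :+ con ½) refl (nat j) ⟩
    nat j · ½ + ½                           ≤⟨ ℚ.+-mono-≤ (harmonic-2^ j) (½≤harmonic P {{ℕ.m^n≢0 2 j}}) ⟩
    harmonic 1 (P ℕ.∸ 1) + harmonic P P
      ≡⟨ cong (λ a → harmonic 1 (P ℕ.∸ 1) + harmonic a P) (ℕ.m∸n+n≡m P>0) ⟨
    harmonic 1 (P ℕ.∸ 1) + harmonic (P ℕ.∸ 1 ℕ.+ 1) P  ≡⟨ harmonic-+ 1 (P ℕ.∸ 1) P ⟨
    harmonic 1 (P ℕ.∸ 1 ℕ.+ P)
      ≡⟨ cong (harmonic 1) (trans (sym (ℕ.+-∸-comm P P>0)) (cong (λ x → P ℕ.+ x ℕ.∸ 1) (sym (ℕ.+-identityʳ P)))) ⟩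
    harmonic 1 (2 ℕ.^ suc j ℕ.∸ 1)          ∎
    where
    open ℚ.≤-Reasoning
    open +-*-Solver
    P = 2 ℕ.^ j
    P>0 : 1 ℕ.≤ P
    P>0 = ℕ.m^n>0 2 j

  -- The lower Riemann sum with unit steps, `1/2 + ⋯ + 1/n`, is precise enough; the lost constant
  -- goes into `C`.
  ln-≽ : ∀ n .{{_ : NonTrivial n}} L → 2 ℕ.^ L ℕ.≤ n → ln n ≽ nat L · ½
  ln-≽ n L 2^L≤n q (_ , (k , refl) , u<q) = begin
    nat L · ½                        ≤⟨ harmonic-2^ L ⟩
    harmonic 1 (2 ℕ.^ L ℕ.∸ 1)
      ≤⟨ harmonic-mono 1 (ℕ.≤-trans (ℕ.∸-monoˡ-≤ 1 2^L≤n) (ℕ.≤-reflexive (sym (ℕ.*-identityʳ (n ℕ.∸ 1))))) ⟩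
    lowerSum n 0                     ≤⟨ lowerSum≤upperSum n 0 k ⟩
    upperSum n k                     ≤⟨ ℚ.<⇒≤ u<q ⟩
    q                                ∎
    where open ℚ.≤-Reasoning

  ⌊log₂⌋ : ∀ n .{{_ : NonZero n}} → ∃[ L ] 2 ℕ.^ L ℕ.≤ n × n ℕ.< 2 ℕ.^ suc L
  ⌊log₂⌋ 1                = 0 , ℕ.≤-refl , ℕ.≤-refl
  ⌊log₂⌋ (suc n@(suc _)) with ⌊log₂⌋ n
  ... | L , 2^L≤n , n<2^1+L with suc n ℕ.<? 2 ℕ.^ suc L
  ...   | yes 1+n< = L , ℕ.m≤n⇒m≤1+n 2^L≤n , 1+n<
  ...   | no  1+n≮ = suc L , ℕ.≮⇒≥ 1+n≮ , ℕ.<-≤-trans (ℕ.s≤s n<2^1+L) (ℕ.+-mono-≤ (ℕ.m^n>0 2 (suc L)) (ℕ.m≤m+n _ 0))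

  nat-^ : ∀ m n → nat (m ℕ.^ n) ≡ nat m ℚ^ n
  nat-^ m zero    = refl
  nat-^ m (suc n) = trans (nat-* m (m ℕ.^ n)) (cong (nat m ·_) (nat-^ m n))

  nat-cancel-≤ : ∀ {m n} → nat m ≤ nat n → m ℕ.≤ n
  nat-cancel-≤ (*≤* m≤n) = ℤ.drop‿+≤+ (subst₂ ℤ._≤_ (ℤ.*-identityʳ _) (ℤ.*-identityʳ _) m≤n)

  ·-^ : ∀ p q n → (p · q) ℚ^ n ≡ p ℚ^ n · q ℚ^ n
  ·-^ p q zero    = refl
  ·-^ p q (suc n) = trans (cong (p · q ·_) (·-^ p q n))
    (solve 4 (λ a b c d → a :* b :* (c :* d) := a :* c :* (b :* d)) refl p q (p ℚ^ n) (q ℚ^ n))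
    where open +-*-Solver

  nat>0 : ∀ n .{{_ : NonZero n}} → 0ℚ < nat n
  nat>0 (suc n) = ℚ.positive⁻¹ (nat (suc n))

  -- The root is not replaced by a rational bound: a rational `z` below it is passed on with only
  -- `z ^ r` controlled, until `clear-root` removes it by taking `r`-th powers.
  scaled-root-≼ : ∀ x y v r ρ .{{_ : NonZero r}} {i u} → x ≼ i → v ≼ u → ∀ {q} →
                  ℝ.lower (ℝ⁺.real (x * y ^[ ρ / r ] * v)) q →
                  ∃[ z ] 0ℚ < z × ℝ⁺.lower (y ^ ρ) (z ℚ^ r) × q ≤ i · z · u
  scaled-root-≼ x y v r ρ {i} {u} x≼i v≼u {q}
    (_ , (a , b , (a>0 , _ , (d , e , (d>0 , ld) , (e>0 , z , (z>0 , lz) , e<z) , refl) , a<de) , (b>0 , lb) , refl) , q<ab) =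
    z , z>0 , lz , (begin
      q          ≤⟨ ℚ.<⇒≤ q<ab ⟩
      a · b      ≤⟨ *-monoˡ-≤ (ℚ.<⇒≤ b>0) (ℚ.<⇒≤ a<de) ⟩
      d · e · b  ≤⟨ *-monoˡ-≤ (ℚ.<⇒≤ b>0) (*-monoˡ-≤ (ℚ.<⇒≤ e>0) (x≼i d ld)) ⟩
      i · e · b  ≤⟨ *-monoˡ-≤ (ℚ.<⇒≤ b>0) (*-monoʳ-≤ i≥0 (ℚ.<⇒≤ e<z)) ⟩
      i · z · b
        ≤⟨ *-monoʳ-≤ (ℚ.≤-trans (ℚ.≤-reflexive (sym (ℚ.*-zeroˡ z))) (*-monoˡ-≤ (ℚ.<⇒≤ z>0) i≥0)) (v≼u b lb) ⟩
      i · z · u  ∎)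
    where
    open ℚ.≤-Reasoning
    i≥0 = ℚ.<⇒≤ (ℚ.<-≤-trans d>0 (x≼i d ld))

  below-bound : ∀ r ρ n c L {i j} .{{_ : NonZero r}} .{{n≢0 : NonZero n}} .{{_ : NonTrivial n}} .{{_ : NonZero c}} .{{_ : NonZero L}} →
                0ℚ < i → i · nat c ≡ 1ℚ → 0ℚ < j → j · (nat L · ½) ≡ 1ℚ → 2 ℕ.^ L ℕ.≤ n → ∀ {q} →
                ℝ.lower (ℝ⁺.real (fromℕ⁺ c ⁻¹ * (fromℕ⁺ n {{n≢0}} / ln n) ^[ ρ / r ] * fromℕ⁺ r ^ n)) q →
                ∃[ z ] 0ℚ < z × z ℚ^ r · nat L ℚ^ ρ ≤ nat (2 ℕ.* n) ℚ^ ρ × q · nat c ≤ z · nat r ℚ^ n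
  below-bound r ρ n c L {i} {j} {{_}} {{n≢0}} i>0 ic≡1 j>0 jl≡1 2^L≤n {q} lq =
    let n/ln≼ = *-≼ (fromℕ⁺ n {{n≢0}}) (ln n ⁻¹) (fromℕ⁺-≼ n {{n≢0}}) (⁻¹-≼ (ln n) j>0 jl≡1 (ln-≽ n L 2^L≤n))
        z , z>0 , lz , q≤ = scaled-root-≼ (fromℕ⁺ c ⁻¹) (fromℕ⁺ n {{n≢0}} / ln n) (fromℕ⁺ r ^ n) r ρ
                              (⁻¹-≼ (fromℕ⁺ c) i>0 ic≡1 (fromℕ⁺-≽ c)) (^-≼ (fromℕ⁺ r) n (fromℕ⁺-≼ r)) lq
    in z , z>0 , root-bound j z jl≡1 (^-≼ (fromℕ⁺ n {{n≢0}} / ln n) ρ n/ln≼ _ lz) , (begin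
      q · nat c                          ≤⟨ *-monoˡ-≤ (ℚ.<⇒≤ (nat>0 c)) q≤ ⟩
      i · z · nat r ℚ^ n · nat c
        ≡⟨ solve 4 (λ i z b c → i :* z :* b :* c := z :* b :* (i :* c)) refl i z (nat r ℚ^ n) (nat c) ⟩
      z · nat r ℚ^ n · (i · nat c)       ≡⟨ trans (cong (z · nat r ℚ^ n ·_) ic≡1) (ℚ.*-identityʳ _) ⟩
      z · nat r ℚ^ n                     ∎)
    where
    open ℚ.≤-Reasoning
    open +-*-Solver
    root-bound : ∀ j z → j · (nat L · ½) ≡ 1ℚ → z ℚ^ r ≤ (nat n · j) ℚ^ ρ → z ℚ^ r · nat L ℚ^ ρ ≤ nat (2 ℕ.* n) ℚ^ ρ
    root-bound j z jl≡1 z^r≤ = begin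
      z ℚ^ r · nat L ℚ^ ρ             ≤⟨ *-monoˡ-≤ (ℚ.<⇒≤ (^-pos ρ (nat>0 L))) z^r≤ ⟩
      (nat n · j) ℚ^ ρ · nat L ℚ^ ρ   ≡⟨ ·-^ (nat n · j) (nat L) ρ ⟨
      (nat n · j · nat L) ℚ^ ρ
        ≡⟨ cong (_ℚ^ ρ) (solve 3 (λ n j l → n :* j :* l
             := con (nat 2) :* n :* (j :* (l :* con ½))) refl (nat n) j (nat L)) ⟩
      (nat 2 · nat n · (j · (nat L · ½))) ℚ^ ρ
        ≡⟨ cong (_ℚ^ ρ) (trans (cong (nat 2 · nat n ·_) jl≡1) (ℚ.*-identityʳ _)) ⟩
      (nat 2 · nat n) ℚ^ ρ            ≡⟨ cong (_ℚ^ ρ) (nat-* 2 n) ⟨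
      nat (2 ℕ.* n) ℚ^ ρ              ∎

  clear-root : ∀ r ρ n c L k .{{_ : NonZero r}} .{{_ : NonZero c}} .{{_ : NonZero L}} {z} → 0ℚ < z →
               z ℚ^ r · nat L ℚ^ ρ ≤ nat (2 ℕ.* n) ℚ^ ρ → nat k · nat c ≤ z · nat r ℚ^ n →
               (k ℕ.* c) ℕ.^ r ℕ.* L ℕ.^ ρ ℕ.≤ (2 ℕ.* n) ℕ.^ ρ ℕ.* (r ℕ.^ n) ℕ.^ r
  -- `^-mono-≤` wants a positive base, so `k = 0` is treated apart.
  clear-root (suc _) ρ n c L zero _ _ _ = ℕ.z≤n
  clear-root r@(suc _) ρ n c L k@(suc _) {z} z>0 z^rL≤ kc≤ = nat-cancel-≤ (begin
    nat ((k ℕ.* c) ℕ.^ r ℕ.* L ℕ.^ ρ)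
      ≡⟨ trans (nat-* ((k ℕ.* c) ℕ.^ r) (L ℕ.^ ρ)) (cong₂ _·_ (nat-^ (k ℕ.* c) r) (nat-^ L ρ)) ⟩
    nat (k ℕ.* c) ℚ^ r · nat L ℚ^ ρ
      ≤⟨ *-monoˡ-≤ (ℚ.<⇒≤ (^-pos ρ (nat>0 L))) (^-mono-≤ r (nat>0 (k ℕ.* c) {{ℕ.m*n≢0 k c}})
                                                      (ℚ.≤-trans (ℚ.≤-reflexive (nat-* k c)) kc≤)) ⟩
    (z · R) ℚ^ r · nat L ℚ^ ρ                   ≡⟨ cong (_· nat L ℚ^ ρ) (·-^ z R r) ⟩
    z ℚ^ r · R ℚ^ r · nat L ℚ^ ρ
      ≡⟨ solve 3 (λ a b c → a :* b :* c := a :* c :* b) refl (z ℚ^ r) (R ℚ^ r) (nat L ℚ^ ρ) ⟩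
    z ℚ^ r · nat L ℚ^ ρ · R ℚ^ r                ≤⟨ *-monoˡ-≤ (ℚ.<⇒≤ (^-pos r (^-pos n (nat>0 r)))) z^rL≤ ⟩
    nat (2 ℕ.* n) ℚ^ ρ · R ℚ^ r
      ≡⟨ cong₂ _·_ (nat-^ (2 ℕ.* n) ρ) (trans (nat-^ (r ℕ.^ n) r) (cong (_ℚ^ r) (nat-^ r n))) ⟨
    nat ((2 ℕ.* n) ℕ.^ ρ) · nat ((r ℕ.^ n) ℕ.^ r) ≡⟨ nat-* ((2 ℕ.* n) ℕ.^ ρ) ((r ℕ.^ n) ℕ.^ r) ⟨
    nat ((2 ℕ.* n) ℕ.^ ρ ℕ.* (r ℕ.^ n) ℕ.^ r)   ∎)
    where
    open ℚ.≤-Reasoning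
    open +-*-Solver
    R = nat r ℚ^ n

  -- The order of ℚ is decidable, so it suffices to refute `nat (size H) ≤ q`: then `size H`
  -- inherits the estimates for `q`, and `H` would be colourable.
  lower-bound : (H : Hypergraph) → ∀ r ρ a c n .{{_ : NonZero r}} .{{_ : NonZero c}} .{{n≢0 : NonZero n}} .{{_ : NonTrivial n}} →
                r ≡ suc ρ → a ≡ 64 ℕ.* (r ℕ.* r) → c ≡ 2 ℕ.* a → a ℕ.≤ n → Uniform H n → ¬ Colorable H r → ∀ {q} →
                ℝ.lower (ℝ⁺.real (fromℕ⁺ c ⁻¹ * (fromℕ⁺ n {{n≢0}} / ln n) ^[ ρ / r ] * fromℕ⁺ r ^ n)) q → q < nat (size H)
  lower-bound H r ρ a c n {{_}} {{_}} {{n≢0}} refl refl c≡ a≤n uniform ¬colorable {q} lq = ℚ.≰⇒> λ k≤q →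
    let L , 2^L≤n , n<2^1+L  = ⌊log₂⌋ n
        instance L≢0         = log≢0 L n<2^1+L
        i , i>0 , ic≡1       = inverse (nat>0 c)
        j , j>0 , jl≡1       = inverse (*-pos (nat>0 L) (ℚ.positive⁻¹ ½))
        z , z>0 , z^r≤ , qc≤ = below-bound r ρ n c L {{_}} {{n≢0}} i>0 ic≡1 j>0 jl≡1 2^L≤n lq
        kc≤                  = ℚ.≤-trans (*-monoˡ-≤ (ℚ.<⇒≤ (nat>0 c)) k≤q) qc≤
    in ¬colorable (few-edges⇒colourable H ρ n L uniform 2^L≤n n<2^1+L a≤n
         (constant-absorbed r ρ n (size H) L a c refl c≡ 8≤c (clear-root r ρ n c L (size H) z>0 z^r≤ kc≤)))
    where
    log≢0 : ∀ L → n ℕ.< 2 ℕ.^ suc L → NonZero L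
    log≢0 zero    n<2 = contradiction (ℕ.nonTrivial⇒n>1 n) (ℕ.<⇒≱ n<2)
    log≢0 (suc _) _   = _
    8≤c : 8 ℕ.≤ c
    8≤c = ℕ.≤-trans (ℕ.m≤m+n 8 56) (ℕ.≤-trans (ℕ.m≤m*n 64 (r ℕ.* r))
      (ℕ.≤-trans (ℕ.m≤n*m a 2) (ℕ.≤-reflexive (sym c≡))))

theorem2 : ∀ r .{{_ : NonTrivial r}} →
    Σ[ C ∈ ℝ⁺ ] ∃[ n₀ ] ∀ n .{{_ : NonTrivial n}} → n₀ ℕ.≤ n →
    ∀ k → m[ n , r ]≡ k →
    ℝ⁺.real (C * (fromℕ⁺ n / ln n) ^[ r ℕ.∸ 1 / r ] * fromℕ⁺ r ^ n) ≤ᴿ fromℕ k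
theorem2 r {{r>1}} = fromℕ⁺ c {{c≢0}} ⁻¹ , a , λ n {{n>1}} a≤n k minimum q lower →
  let H , uniform , ¬colorable , size≡k = m[_,_]≡_.attained minimum
  in _ , refl , subst (q <_) (RationalLemmas.nat≡ k)
       (subst (λ k → q < RationalLemmas.nat k) size≡k
         (Bounds.lower-bound H r (r ℕ.∸ 1) a c n
           {{ℕ.nonTrivial⇒nonZero r {{r>1}}}} {{c≢0}} {{ℕ.nonTrivial⇒nonZero n {{n>1}}}} {{n>1}}
           r≡ refl refl a≤n uniform ¬colorable lower))
  where
  a c : ℕ
  -- In `few-edges⇒colourable`, `a` is both the threshold for `n` and the coefficient of `L`. It is
  -- doubled in `c` because `ln n ≥ L / 2` only gives `n / ln n ≤ 2 n / L`.
  a = 64 ℕ.* (r ℕ.* r)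
  c = 2 ℕ.* a
  c≢0 : NonZero c
  c≢0 = ℕ.m*n≢0 2 a {{_}} {{ℕ.m*n≢0 64 (r ℕ.* r) {{_}} {{ℕ.m*n≢0 r r}}}}
  r≡ : r ≡ suc (r ℕ.∸ 1)
  r≡ = sym (ℕ.suc-pred r)
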